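{- Let $q$ be a prime power, $n\ge3$, $\sigma$ a generator of $\mathrm{Gal}(\mathbb{F}_{q^n}/\mathbb{F}_q)$, and $L=ax+bx^{\sigma}+cx^{\sigma^2}+dx^{\sigma^3}$ with $a,b,c,d\in\mathbb{F}_{q^n}$ and $abcd\neq0$. Then $P_L(y)=a+by+cy^{\sigma+1}+dy^{\sigma^2+\sigma+1}$ has $q^2+q+1$ roots in $\mathbb{F}_{q^n}$ if and only if $H_{n-1}=H_{n-2}=0$ and $H_n\in\mathbb{F}_q$.
   Context: Let $w=\frac{a^\sigma c}{b^{\sigma+1}}$ and $z=\frac{b^\sigma d}{c^{\sigma+1}}$. Define $H_0=1$, $H_1=-1$, $H_2=1-z$, and for $k\ge3$, $H_k=-H_{k-1}-z^{\sigma^{k-2}}H_{k-2}-w^{\sigma^{k-2}}z^{\sigma^{k-2}+\sigma^{k-3}}H_{k-3}$ (so e.g. $H_3=z^\sigma+z-1-w^\sigma z^{1+\sigma}$). -}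

module Defs where

open import Level using (0ℓ)
open import Algebra.Bundles using (CommutativeRing)
open import Data.Nat using (ℕ; zero; suc; _≤_; _<_; _^_)
open import Data.Nat.Primality using (Prime)
open import Data.Fin using (Fin)
open import Data.Product using (Σ; ∃; _×_)
open import Relation.Nullary using (¬_)
open import Relation.Binary.PropositionalEquality using (_≡_)

-- A field: a commutative ring (setoid equality _≈_) with 0 ≉ 1 and
-- multiplicative inverses of nonzero elements (the value of _⁻¹ at 0 is irrelevant).
record Field : Set₁ where
  field
    commutativeRing : CommutativeRing 0ℓ 0ℓ
  open CommutativeRing commutativeRing public
  field
    _⁻¹        : Carrier → Carrier
    0≉1        : ¬ (0# ≈ 1#)
    ⁻¹-inverse : ∀ x → ¬ (x ≈ 0#) → (x * (x ⁻¹)) ≈ 1#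

IsPrimePower : ℕ → Set
IsPrimePower q = Σ ℕ λ p → Σ ℕ λ k → Prime p × 1 ≤ k × q ≡ p ^ k

module FieldDefs (F : Field) where
  open Field F public

  pow : Carrier → ℕ → Carrier
  pow x zero    = 1#
  pow x (suc m) = x * pow x m

  iter : (Carrier → Carrier) → ℕ → Carrier → Carrier
  iter f zero    x = x
  iter f (suc j) x = f (iter f j x)

  -- the set {x | P x} (P respecting ≈) has exactly N elements (up to ≈)
  HasExactly : (Carrier → Set) → ℕ → Set
  HasExactly P N =
    Σ (Fin N → Carrier) λ r →
      (∀ i j → r i ≈ r j → i ≡ j) ×
      (∀ i → P (r i)) ×
      (∀ y → P y → ∃ λ i → y ≈ r i)

  HasCard : ℕ → Set
  HasCard m = HasExactly (λ _ → Data.Unit.⊤) m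
    where import Data.Unit

  -- σ is a generator of Gal(F / F_q), where F has q^n elements and
  -- F_q = {x | x^q = x} is its subfield with q elements: σ is a field
  -- automorphism of F fixing F_q pointwise, and σ^j ≠ id for 0 < j < n
  -- (so σ has order n = |Gal(F_{q^n}/F_q)|).
  record IsGaloisGenerator (q n : ℕ) (σ : Carrier → Carrier) : Set where
    field
      cong-σ    : ∀ {x y} → x ≈ y → σ x ≈ σ y
      σ-+       : ∀ x y → σ (x + y) ≈ (σ x + σ y)
      σ-*       : ∀ x y → σ (x * y) ≈ (σ x * σ y)
      σ-1       : σ 1# ≈ 1#
      σ-inj     : ∀ x y → σ x ≈ σ y → x ≈ y
      σ-surj    : ∀ y → ∃ λ x → σ x ≈ y
      σ-fixes-Fq : ∀ x → pow x q ≈ x → σ x ≈ x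
      σ-order   : ∀ j → 0 < j → j < n → ∃ λ x → ¬ (iter σ j x ≈ x)

  module _ (σ : Carrier → Carrier) where
    P_L : Carrier → Carrier → Carrier → Carrier → Carrier → Carrier
    P_L a b c d y = a + b * y + c * (σ y * y) + d * (iter σ 2 y * σ y * y)

    wL : Carrier → Carrier → Carrier → Carrier
    wL a b c = (σ a * c) * ((σ b * b) ⁻¹)

    zL : Carrier → Carrier → Carrier → Carrier
    zL b c d = (σ b * d) * ((σ c * c) ⁻¹)

    H : Carrier → Carrier → ℕ → Carrier
    H w z zero = 1#
    H w z (suc zero) = - 1#
    H w z (suc (suc zero)) = 1# + - z
    H w z (suc (suc (suc k))) =
      - H w z (suc (suc k))
      + - (iter σ (suc k) z * H w z (suc k))
      + - (iter σ (suc k) w * (iter σ (suc k) z * iter σ k z) * H w z k)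

{-# OPTIONS --safe #-}
-- Put u(y) = (1 , y , y σ(y)).  The recurrence σᵏ(a) sₖ + σᵏ(b) sₖ₊₁ + σᵏ(c) sₖ₊₂ + σᵏ(d) sₖ₊₃ = 0 has the
-- solution sₖ = y σ(y) ⋯ σᵏ⁻¹(y) for every root y of P_L, so u(y) is an eigenvector, with eigenvalue norm y, of
-- the linear map A : (s₀ , s₁ , s₂) ↦ (sₙ , sₙ₊₁ , sₙ₊₂).  The solution starting with 0, 0, 1 is, up to nonzero
-- factors, the sequence H; hence the condition on H says that (0 , 0 , 1) is an eigenvector of A with eigenvalue
-- in Fix σ = F_q, which amounts to A being a scalar of F_q.
--
-- If there are q² + q + 1 roots, four of the points u(y) are in general position, because the sides of a triangle
-- contain at most 3 q of them; so A is scalar.  Conversely let A be the scalar λ and choose μ of norm λ.  Then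
-- x ↦ μ σ(x) / x maps the nonzero zeros of L' = a + b μ σ + c μ σ(μ) σ² + d μ σ(μ) σ²(μ) σ³ to roots of P_L, and a
-- trace argument shows that the zeros of L' have dimension 3 over F_q.
module Submission where

-- Besides being an automorphism, σ is only assumed to fix the solutions of x^q = x and to have σʲ ≠
-- id for 0 < j < n. That Fix σ has exactly q elements and that σⁿ = id must be proved, and both
-- come from counting: factoring x^(qⁿ) - x supplies q fixed elements, and Dedekind independence of
-- 1, σ, σ², ... over F bounds their number from above.
--
-- A solution of the recurrence is determined by its first three terms, so every identity between
-- solutions is checked at the indices 0, 1, 2 only, and no matrix of A is ever written down.
--
-- The converse uses the single solution starting with 0, 0, 1. Division by the partial norms of μ
-- turns its periodicity up to λ into exact periodicity, which makes its traces zeros of L'. Its two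
-- initial zeros leave the trace operator with only n - 2 terms, and independence then yields three
-- values that are independent over Fix σ. Their projective plane gives q² + q + 1 roots. That there
-- are no others is a separate count, 1 + (q + 1) q: one root, the slopes of lines through it, and
-- the further roots on each line.

open import Defs
open import Level using (0ℓ)
open import Data.Nat as ℕ using (ℕ; zero; suc; _≤_; _<_; z≤n; s≤s; _∸_; _^_) renaming (_+_ to _+ℕ_)
import Data.Nat.Properties as ℕₚ
open import Data.Nat.Primality using (prime⇒nonTrivial)
open import Data.Nat.Solver using (module +-*-Solver)
open import Data.Fin as Fin using (Fin; zero; suc)
import Data.Fin.Properties as Finₚ
open import Data.Fin.Permutation using (permutation)
open import Data.List using (List; []; _∷_; _++_; length; map; replicate)
import Data.List.Properties as Listₚ
open import Data.Maybe using (Maybe; just; nothing)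
open import Data.Empty using (⊥)
open import Data.Unit using (⊤; tt)
open import Data.Sum as Sum using (_⊎_; inj₁; inj₂)
import Data.Sum.Properties as Sumₚ
open import Data.Product using (Σ; ∃; _×_; _,_; proj₁; proj₂)
open import Function using (_∘_; id)
open import Function.Bundles using (_⇔_; mk⇔)
open import Relation.Nullary using (¬_; Dec; yes; no; contradiction)
import Relation.Nullary.Decidable as Dec
open import Relation.Binary.PropositionalEquality as ≡ using (_≡_)
import Relation.Binary.Reasoning.Setoid as SetoidReasoning
open import Algebra.Bundles using (CommutativeRing; RawRing)
import Algebra.Properties.Ring as RingProperties
import Algebra.Properties.CommutativeSemigroup as CommutativeSemigroupProperties
import Algebra.Properties.CommutativeMonoid.Sum as CommutativeMonoidSum
import Algebra.Properties.Semiring.Mult as Mult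
open import Algebra.Solver.Ring.AlmostCommutativeRing
  using (fromCommutativeRing; _-Raw-AlmostCommutative⟶_)
import Algebra.Solver.Ring

-- The library's solver only cancels x - x when it can compute with the
-- coefficients; formal differences (m , n) = m - n of naturals serve for that.
module RingSolver (R : CommutativeRing 0ℓ 0ℓ) where
  open CommutativeRing R hiding (zero)
  open RingProperties ring
  open CommutativeSemigroupProperties +-commutativeSemigroup using (interchange)
  open Mult semiring using (×-homo-+; ×1-homo-*) renaming (_×_ to _·_)
  open SetoidReasoning setoid

  private
    -- Every integer has one reduced representative, so a coefficient that cancels becomes literally
    -- `(0 , 0)`.
    reduce : ℕ × ℕ → ℕ × ℕ
    reduce (suc a , suc b) = reduce (a , b)
    reduce x = x

    D : RawRing 0ℓ 0ℓ
    D = record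
      { Carrier = ℕ × ℕ
      ; _≈_ = _≡_
      ; _+_ = λ { (a , b) (c , d) → reduce (a ℕ.+ c , b ℕ.+ d) }
      ; _*_ = λ { (a , b) (c , d) → reduce (a ℕ.* c ℕ.+ b ℕ.* d , a ℕ.* d ℕ.+ b ℕ.* c) }
      ; -_  = λ { (a , b) → b , a }
      ; 0#  = 0 , 0
      ; 1#  = 1 , 0
      }

    ⟦_⟧ : ℕ × ℕ → Carrier
    ⟦ m , n ⟧ = m · 1# - n · 1#

    -- the value used by the solver, which is judgementally 0# at 0 and 1# at 1
    value : ℕ × ℕ → Carrier
    value (0 , 0) = 0#
    value (1 , 0) = 1#
    value x = ⟦ x ⟧

    sub-+ : ∀ p q r s → (p + q) - (r + s) ≈ (p - r) + (q - s)
    sub-+ p q r s = begin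
      (p + q) - (r + s)      ≈⟨ +-congˡ (-‿+-comm r s) ⟨
      (p + q) + (- r + - s)  ≈⟨ interchange p q (- r) (- s) ⟩
      (p - r) + (q - s)      ∎

    neg-sub : ∀ p q → q - p ≈ - (p - q)
    neg-sub p q = begin
      q - p          ≈⟨ +-comm q (- p) ⟩
      - p + q        ≈⟨ +-congˡ (-‿involutive q) ⟨
      - p + - (- q)  ≈⟨ -‿+-comm p (- q) ⟩
      - (p - q)      ∎

    homo* : ∀ p q r s → (p * r + q * s) - (p * s + q * r) ≈ (p - q) * (r - s)
    homo* p q r s = begin
      (p * r + q * s) - (p * s + q * r)    ≈⟨ sub-+ _ _ _ _ ⟩
      (p * r - p * s) + (q * s - q * r)    ≈⟨ +-congˡ (neg-sub (q * r) (q * s)) ⟩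
      (p * r - p * s) - (q * r - q * s)    ≈⟨ +-cong (x[y-z]≈xy-xz p r s) (-‿cong (x[y-z]≈xy-xz q r s)) ⟨
      p * (r - s) - q * (r - s)            ≈⟨ [y-z]x≈yx-zx (r - s) p q ⟨
      (p - q) * (r - s)                    ∎

    split : ∀ a b c d → (a ℕ.* c ℕ.+ b ℕ.* d) · 1# ≈ (a · 1#) * (c · 1#) + (b · 1#) * (d · 1#)
    split a b c d = trans (×-homo-+ 1# (a ℕ.* c) (b ℕ.* d)) (+-cong (×1-homo-* a c) (×1-homo-* b d))

    value≈ : ∀ x → value x ≈ ⟦ x ⟧
    value≈ (0 , 0) = sym (-‿inverseʳ 0#)
    value≈ (1 , 0) = sym (trans (+-congˡ -0#≈0#) (trans (+-identityʳ _) (+-identityʳ 1#)))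
    value≈ (0 , suc _) = refl
    value≈ (1 , suc _) = refl
    value≈ (suc (suc _) , _) = refl

    value-reduce : ∀ x → value (reduce x) ≈ ⟦ x ⟧
    value-reduce (zero , b) = value≈ (zero , b)
    value-reduce (suc a , zero) = value≈ (suc a , zero)
    value-reduce (suc a , suc b) = begin
      value (reduce (a , b))             ≈⟨ value-reduce (a , b) ⟩
      a · 1# - b · 1#                    ≈⟨ +-identityˡ _ ⟨
      0# + (a · 1# - b · 1#)             ≈⟨ +-congʳ (-‿inverseʳ 1#) ⟨
      (1# - 1#) + (a · 1# - b · 1#)      ≈⟨ sub-+ _ _ _ _ ⟨
      suc a · 1# - suc b · 1#            ∎

    morphism : D -Raw-AlmostCommutative⟶ fromCommutativeRing R
    morphism = record
      { ⟦_⟧ = value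
      ; +-homo = λ { x@(a , b) y@(c , d) → begin
          value (reduce (a ℕ.+ c , b ℕ.+ d))             ≈⟨ value-reduce (a ℕ.+ c , b ℕ.+ d) ⟩
          (a ℕ.+ c) · 1# - (b ℕ.+ d) · 1#                ≈⟨ +-cong (×-homo-+ 1# a c) (-‿cong (×-homo-+ 1# b d)) ⟩
          (a · 1# + c · 1#) - (b · 1# + d · 1#)          ≈⟨ sub-+ _ _ _ _ ⟩
          ⟦ x ⟧ + ⟦ y ⟧                                  ≈⟨ +-cong (value≈ x) (value≈ y) ⟨
          value x + value y                              ∎ }
      ; *-homo = λ { x@(a , b) y@(c , d) → begin
          value (reduce (a ℕ.* c ℕ.+ b ℕ.* d , a ℕ.* d ℕ.+ b ℕ.* c))  ≈⟨ value-reduce (a ℕ.* c ℕ.+ b ℕ.* d , a ℕ.* d ℕ.+ b ℕ.* c) ⟩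
          _                                                  ≈⟨ +-cong (split a b c d) (-‿cong (split a b d c)) ⟩
          _                                                  ≈⟨ homo* _ _ _ _ ⟩
          ⟦ x ⟧ * ⟦ y ⟧                                      ≈⟨ *-cong (value≈ x) (value≈ y) ⟨
          value x * value y                                  ∎ }
      ; -‿homo = λ { x@(a , b) → begin
          value (b , a)  ≈⟨ value≈ (b , a) ⟩
          ⟦ b , a ⟧      ≈⟨ neg-sub (a · 1#) (b · 1#) ⟩
          - ⟦ x ⟧        ≈⟨ -‿cong (value≈ x) ⟨
          - value x      ∎ }
      ; 0-homo = refl
      ; 1-homo = refl
      }

    dec : ∀ x y → Maybe (value x ≈ value y)
    dec x@(a , b) y@(c , d) with a ℕ.+ d ℕ.≟ c ℕ.+ b
    ... | no _ = nothing
    ... | yes eq = just (begin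
      value x                                ≈⟨ value≈ x ⟩
      a · 1# - b · 1#                        ≈⟨ +-identityʳ _ ⟨
      (a · 1# - b · 1#) + 0#                 ≈⟨ +-congˡ (-‿inverseʳ (d · 1#)) ⟨
      (a · 1# - b · 1#) + (d · 1# - d · 1#)  ≈⟨ sub-+ _ _ _ _ ⟨
      (a · 1# + d · 1#) - (b · 1# + d · 1#)  ≈⟨ +-cong (×-homo-+ 1# a d) refl ⟨
      (a ℕ.+ d) · 1# - (b · 1# + d · 1#)     ≡⟨ ≡.cong (λ k → k · 1# - (b · 1# + d · 1#)) eq ⟩
      (c ℕ.+ b) · 1# - (b · 1# + d · 1#)     ≈⟨ +-cong (×-homo-+ 1# c b) (-‿cong (+-comm _ _)) ⟩
      (c · 1# + b · 1#) - (d · 1# + b · 1#)  ≈⟨ sub-+ _ _ _ _ ⟩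
      (c · 1# - d · 1#) + (b · 1# - b · 1#)  ≈⟨ +-congˡ (-‿inverseʳ (b · 1#)) ⟩
      (c · 1# - d · 1#) + 0#                 ≈⟨ +-identityʳ _ ⟩
      c · 1# - d · 1#                        ≈⟨ value≈ y ⟨
      value y                                ∎)

  open Algebra.Solver.Ring D (fromCommutativeRing R) morphism dec public
    using (solve; _:=_; _:+_; _:*_; _:-_; :-_; con; Polynomial)

  :0 :1 : ∀ {k} → Polynomial k
  :0 = con (0 , 0)
  :1 = con (1 , 0)

-- Decidable subsets of finite sets, and cancellation in fields

enumerate : ∀ {k} {P : Fin k → Set} → (∀ i → Dec (P i)) →
            Σ ℕ λ c → Σ (Fin c → Fin k) λ g →
              (∀ i j → g i ≡ g j → i ≡ j) × (∀ i → P (g i)) × (∀ i → P i → ∃ λ j → g j ≡ i)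
enumerate {zero} P? = 0 , (λ ()) , (λ ()) , (λ ()) , λ ()
enumerate {suc k} P? with enumerate (P? ∘ suc)
... | c , g , inj , sound , complete with P? zero
...   | no ¬p = c , suc ∘ g , (λ i j eq → inj i j (Finₚ.suc-injective eq)) , sound ,
          λ { zero p → contradiction p ¬p
            ; (suc i) p → let j , eq = complete i p in j , ≡.cong suc eq }
...   | yes p₀ = suc c , g′ , inj′ , sound′ , complete′
  where
  g′ : Fin (suc c) → Fin (suc k)
  g′ zero = zero
  g′ (suc i) = suc (g i)
  inj′ : ∀ i j → g′ i ≡ g′ j → i ≡ j
  inj′ zero zero eq = ≡.refl
  inj′ (suc i) (suc j) eq = ≡.cong suc (inj i j (Finₚ.suc-injective eq))
  sound′ : ∀ i → _
  sound′ zero = p₀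
  sound′ (suc i) = sound i
  complete′ : ∀ i → _ → ∃ λ j → g′ j ≡ i
  complete′ zero _ = zero , ≡.refl
  complete′ (suc i) p = let j , eq = complete i p in suc j , ≡.cong suc eq

module FieldProperties (F : Field) where
  open FieldDefs F hiding (zero)
  open RingSolver commutativeRing
  open SetoidReasoning setoid

  x-y≈0⇒x≈y : ∀ {x y} → x - y ≈ 0# → x ≈ y
  x-y≈0⇒x≈y {x} {y} eq = begin
    x            ≈⟨ solve 2 (λ x y → x := (x :- y) :+ y) refl x y ⟩
    (x - y) + y  ≈⟨ +-congʳ eq ⟩
    0# + y       ≈⟨ +-identityˡ y ⟩
    y            ∎

  x≈y⇒x-y≈0 : ∀ {x y} → x ≈ y → x - y ≈ 0#
  x≈y⇒x-y≈0 {x} {y} eq = trans (+-congʳ eq) (-‿inverseʳ y)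

  inverseˡ : ∀ {x} → ¬ x ≈ 0# → x ⁻¹ * x ≈ 1#
  inverseˡ {x} x≉0 = trans (*-comm _ x) (⁻¹-inverse x x≉0)

  *-cancelˡ : ∀ {x y z} → ¬ x ≈ 0# → x * y ≈ x * z → y ≈ z
  *-cancelˡ {x} {y} {z} x≉0 eq = begin
    y               ≈⟨ *-identityˡ y ⟨
    1# * y          ≈⟨ *-congʳ (inverseˡ x≉0) ⟨
    x ⁻¹ * x * y    ≈⟨ *-assoc _ x y ⟩
    x ⁻¹ * (x * y)  ≈⟨ *-congˡ eq ⟩
    x ⁻¹ * (x * z)  ≈⟨ *-assoc _ x z ⟨
    x ⁻¹ * x * z    ≈⟨ *-congʳ (inverseˡ x≉0) ⟩
    1# * z          ≈⟨ *-identityˡ z ⟩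
    z               ∎

  *-cancelʳ : ∀ {x y z} → ¬ x ≈ 0# → y * x ≈ z * x → y ≈ z
  *-cancelʳ x≉0 eq = *-cancelˡ x≉0 (trans (*-comm _ _) (trans eq (*-comm _ _)))

  x*y≈0⇒y≈0 : ∀ {x y} → ¬ x ≈ 0# → x * y ≈ 0# → y ≈ 0#
  x*y≈0⇒y≈0 {x} x≉0 eq = *-cancelˡ x≉0 (trans eq (sym (zeroʳ x)))

  x*y≈0⇒x≈0 : ∀ {x y} → ¬ y ≈ 0# → x * y ≈ 0# → x ≈ 0#
  x*y≈0⇒x≈0 y≉0 eq = x*y≈0⇒y≈0 y≉0 (trans (*-comm _ _) eq)

  *-≉0 : ∀ {x y} → ¬ x ≈ 0# → ¬ y ≈ 0# → ¬ x * y ≈ 0#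
  *-≉0 x≉0 y≉0 eq = y≉0 (x*y≈0⇒y≈0 x≉0 eq)

  *-≉0⇒≉0ˡ : ∀ {x y} → ¬ x * y ≈ 0# → ¬ x ≈ 0#
  *-≉0⇒≉0ˡ {x} {y} xy≉0 eq = xy≉0 (trans (*-congʳ eq) (zeroˡ y))

  *-≉0⇒≉0ʳ : ∀ {x y} → ¬ x * y ≈ 0# → ¬ y ≈ 0#
  *-≉0⇒≉0ʳ {x} {y} xy≉0 eq = xy≉0 (trans (*-congˡ eq) (zeroʳ x))

  1≉0 : ¬ 1# ≈ 0#
  1≉0 = 0≉1 ∘ sym

  ⁻¹-≉0 : ∀ {x} → ¬ x ≈ 0# → ¬ x ⁻¹ ≈ 0#
  ⁻¹-≉0 {x} x≉0 = *-≉0⇒≉0ʳ (λ eq → 1≉0 (trans (sym (⁻¹-inverse x x≉0)) eq))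

  ≉⇒-≉0 : ∀ {x y} → ¬ x ≈ y → ¬ x - y ≈ 0#
  ≉⇒-≉0 x≉y = x≉y ∘ x-y≈0⇒x≈y

  ≉0-resp : ∀ {x y} → x ≈ y → ¬ x ≈ 0# → ¬ y ≈ 0#
  ≉0-resp x≈y x≉0 y≈0 = x≉0 (trans x≈y y≈0)

  /-cancel : ∀ {x y} → ¬ y ≈ 0# → x * y ⁻¹ * y ≈ x
  /-cancel {x} {y} y≉0 = trans (*-assoc x _ y) (trans (*-congˡ (inverseˡ y≉0)) (*-identityʳ x))

-- Counting in a finite field by injections

module Finite (F : Field) (N : ℕ) (card : FieldDefs.HasCard F N) where
  open FieldDefs F hiding (zero)
  open FieldProperties F

  elem : Fin N → Carrier
  elem = proj₁ card

  index : Carrier → Fin N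
  index y = proj₁ (proj₂ (proj₂ (proj₂ card)) y tt)

  elem-index : ∀ y → y ≈ elem (index y)
  elem-index y = proj₂ (proj₂ (proj₂ (proj₂ card)) y tt)

  elem-injective : ∀ {i j} → elem i ≈ elem j → i ≡ j
  elem-injective = proj₁ (proj₂ card) _ _

  index-cong : ∀ {x y} → x ≈ y → index x ≡ index y
  index-cong {x} {y} eq = elem-injective (trans (sym (elem-index x)) (trans eq (elem-index y)))

  index-injective : ∀ {x y} → index x ≡ index y → x ≈ y
  index-injective {x} {y} eq =
    trans (elem-index x) (trans (reflexive (≡.cong elem eq)) (sym (elem-index y)))

  infix 4 _≟_
  _≟_ : ∀ x y → Dec (x ≈ y)
  x ≟ y = Dec.map′ index-injective index-cong (index x Finₚ.≟ index y)

  -- Equivalent elements have identical representatives, so data indexed by field elements can be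
  -- used without assuming that it respects `_≈_`.
  canon : Carrier → Carrier
  canon y = elem (index y)

  canon-cong : ∀ {x y} → x ≈ y → canon x ≡ canon y
  canon-cong eq = ≡.cong elem (index-cong eq)

  Resp : (Carrier → Set) → Set
  Resp P = ∀ {x y} → x ≈ y → P x → P y

  search : ∀ {P : Carrier → Set} → Resp P → (∀ x → Dec (P x)) → Dec (∃ P)
  search resp P? = Dec.map′ (λ { (i , p) → elem i , p })
    (λ { (x , p) → index x , resp (elem-index x) p }) (Finₚ.any? (P? ∘ elem))

  every : ∀ {P : Carrier → Set} → Resp P → (∀ x → Dec (P x)) → (∃ λ x → ¬ P x) ⊎ (∀ x → P x)
  every resp P? with search (λ eq ¬p p → ¬p (resp (sym eq) p)) (λ x → Dec.¬? (P? x))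
  ... | yes ∃¬p = inj₁ ∃¬p
  ... | no ∄¬p = inj₂ λ x → Dec.decidable-stable (P? x) (λ ¬p → ∄¬p (x , ¬p))

  x*y≈0⇒ : ∀ {x y} → x * y ≈ 0# → x ≈ 0# ⊎ y ≈ 0#
  x*y≈0⇒ {x} eq with x ≟ 0#
  ... | yes x≈0 = inj₁ x≈0
  ... | no x≉0 = inj₂ (x*y≈0⇒y≈0 x≉0 eq)

  -- An injection into `Fin m` needs no enumeration of `P`, so bounds can be transported and added
  -- freely. The injectivity clause ranges over all proofs of `P`, so an element is counted once
  -- however membership is proved.
  AtMost : (Carrier → Set) → ℕ → Set
  AtMost P m = Σ (∀ y → P y → Fin m) λ g → ∀ {y z} p p′ → g y p ≡ g z p′ → y ≈ z

  HasExactly⇒AtMost : ∀ {P m} → HasExactly P m → AtMost P m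
  HasExactly⇒AtMost (r , inj , _ , complete) =
    (λ y p → proj₁ (complete y p)) ,
    λ {y} {z} p p′ eq → trans (proj₂ (complete y p))
      (trans (reflexive (≡.cong r eq)) (sym (proj₂ (complete z p′))))

  AtMost-⊤ : AtMost (λ _ → ⊤) N
  AtMost-⊤ = HasExactly⇒AtMost card

  AtMost-via : ∀ {P Q m} → AtMost Q m → (f : ∀ y → P y → Carrier) → (∀ y p → Q (f y p)) →
               (∀ {y z} p p′ → f y p ≈ f z p′ → y ≈ z) → AtMost P m
  AtMost-via (g , g-inj) f f-Q f-inj =
    (λ y p → g (f y p) (f-Q y p)) , λ p p′ eq → f-inj p p′ (g-inj _ _ eq)

  AtMost-mono : ∀ {P m k} → m ≤ k → AtMost P m → AtMost P k
  AtMost-mono m≤k (g , g-inj) = (λ y p → Fin.inject≤ (g y p) m≤k) ,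
    λ p p′ eq → g-inj p p′ (Finₚ.inject≤-injective m≤k m≤k _ _ eq)

  AtMost-∪ : ∀ {P Q R m k} → AtMost P m → AtMost Q k → (∀ y → R y → P y ⊎ Q y) → AtMost R (m ℕ.+ k)
  AtMost-∪ {P} {Q} {R} {m} {k} (g , g-inj) (h , h-inj) cover =
    (λ y r → Fin.join m k (code (cover y r))) ,
    λ {y} {z} r r′ eq → code-inj (cover y r) (cover z r′)
      (≡.trans (≡.sym (Finₚ.splitAt-join m k _))
        (≡.trans (≡.cong (Fin.splitAt m) eq) (Finₚ.splitAt-join m k _)))
    where
    code : ∀ {y} → P y ⊎ Q y → Fin m ⊎ Fin k
    code (inj₁ p) = inj₁ (g _ p)
    code (inj₂ q) = inj₂ (h _ q)
    code-inj : ∀ {y z} (s : P y ⊎ Q y) (t : P z ⊎ Q z) → code s ≡ code t → y ≈ z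
    code-inj (inj₁ p) (inj₁ p′) eq = g-inj p p′ (Sumₚ.inj₁-injective eq)
    code-inj (inj₂ q) (inj₂ q′) eq = h-inj q q′ (Sumₚ.inj₂-injective eq)

  -- An element is coded by its value under `f` and its place in the fibre. The fibre is taken over
  -- the canonical representative, so that elements with equivalent values are placed by the same
  -- injection.
  AtMost-fibres : ∀ {P Q m k} → AtMost Q m → (f : ∀ y → P y → Carrier) → (∀ y p → Q (f y p)) →
                  (∀ s → AtMost (λ y → Σ (P y) λ p → f y p ≈ s) k) → AtMost P (m ℕ.* k)
  AtMost-fibres {P} {m = m} {k} (g , g-inj) f f-Q fibre =
    (λ y p → Fin.combine (g _ (f-Q y p)) (place y p)) ,
    λ {y} {z} p p′ eq → place-inj p p′
      (g-inj (f-Q y p) (f-Q z p′) (Finₚ.combine-injectiveˡ _ (place y p) _ (place z p′) eq))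
      (Finₚ.combine-injectiveʳ (g _ (f-Q y p)) (place y p) (g _ (f-Q z p′)) (place z p′) eq)
    where
    place : ∀ y → P y → Fin k
    place y p = proj₁ (fibre (canon (f y p))) y (p , elem-index _)
    place-inj : ∀ {y z} p p′ → f y p ≈ f z p′ → place y p ≡ place z p′ → y ≈ z
    place-inj {y} {z} p p′ eq = go (canon-cong eq) (elem-index _) (elem-index _)
      where
      go : ∀ {s t} → s ≡ t → (e : f y p ≈ s) (e′ : f z p′ ≈ t) →
           proj₁ (fibre s) y (p , e) ≡ proj₁ (fibre t) z (p′ , e′) → y ≈ z
      go {s} ≡.refl e e′ = proj₂ (fibre s) (p , e) (p′ , e′)

  AtMost-singleton : ∀ x → AtMost (_≈ x) 1
  AtMost-singleton x = (λ _ _ → zero) , λ p p′ _ → trans p (sym p′)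

  abstract
    AtMost⇒≤ : ∀ {P m k} → AtMost P m → (f : Fin k → Carrier) → (∀ i → P (f i)) →
               (∀ i j → f i ≈ f j → i ≡ j) → k ≤ m
    AtMost⇒≤ (g , g-inj) f f-P f-inj =
      Finₚ.injective⇒≤ {f = λ i → g (f i) (f-P i)} (λ eq → f-inj _ _ (g-inj _ _ eq))

    -- Pigeonhole: an element missed by `f` would extend it to `suc m` distinct elements.
    AtMost⇒complete : ∀ {P m} → AtMost P m → (f : Fin m → Carrier) → (∀ i → P (f i)) →
                      (∀ i j → f i ≈ f j → i ≡ j) → ∀ y → P y → ∃ λ i → y ≈ f i
    AtMost⇒complete {P} {m} bound f f-P f-inj y p with Finₚ.any? (λ i → y ≟ f i)
    ... | yes found = found
    ... | no ¬found = contradiction (AtMost⇒≤ bound f′ f′-P f′-inj) (ℕₚ.<-irrefl ≡.refl)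
      where
      f′ : Fin (suc m) → Carrier
      f′ zero = y
      f′ (suc i) = f i
      f′-P : ∀ i → P (f′ i)
      f′-P zero = p
      f′-P (suc i) = f-P i
      f′-inj : ∀ i j → f′ i ≈ f′ j → i ≡ j
      f′-inj zero zero _ = ≡.refl
      f′-inj zero (suc j) eq = contradiction (j , eq) ¬found
      f′-inj (suc i) zero eq = contradiction (i , sym eq) ¬found
      f′-inj (suc i) (suc j) eq = ≡.cong suc (f-inj i j eq)

    AtMost⇒outside : ∀ {P R : Carrier → Set} {m k} → (∀ x → Dec (R x)) → AtMost (λ x → P x × R x) m → m < k →
                     HasExactly P k → ∃ λ x → P x × ¬ R x
    AtMost⇒outside {P} {R} R? bound m<k (f , f-inj , f-P , _) with Finₚ.any? (λ i → Dec.¬? (R? (f i)))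
    ... | yes (i , ¬r) = f i , f-P i , ¬r
    ... | no ∄ = contradiction
      (AtMost⇒≤ {P = λ x → P x × R x} bound f (λ i → f-P i , Dec.decidable-stable (R? (f i)) (λ ¬r → ∄ (i , ¬r))) f-inj)
      (ℕₚ.<⇒≱ m<k)

    count : ∀ {P : Carrier → Set} → Resp P → (∀ x → Dec (P x)) → ∃ λ c → HasExactly P c
    count resp P? with enumerate (P? ∘ elem)
    ... | c , g , inj , sound , complete =
      c , elem ∘ g , (λ i j eq → inj i j (elem-injective eq)) , sound ,
      λ y p → let j , eq = complete (index y) (resp (elem-index y) p)
              in j , trans (elem-index y) (reflexive (≡.cong elem (≡.sym eq)))

    -- The values of `f` on an enumeration of `P` are as many distinct elements of `P` as there are.
    -- Surjectivity of the norm rests on this.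
    injective⇒surjective : ∀ {P : Carrier → Set} → Resp P → (∀ x → Dec (P x)) →
      (f : ∀ x → P x → Carrier) → (∀ x p → P (f x p)) → (∀ {x y} p p′ → f x p ≈ f y p′ → x ≈ y) →
      ∀ y → P y → Σ Carrier λ x → Σ (P x) λ p → y ≈ f x p
    injective⇒surjective resp P? f f-P f-inj y py with count resp P?
    ... | c , exact@(r , r-inj , r-P , _)
        with AtMost⇒complete (HasExactly⇒AtMost exact) (λ i → f (r i) (r-P i)) (λ i → f-P _ _)
               (λ i j eq → r-inj i j (f-inj _ _ eq)) y py
    ...   | i , eq = r i , r-P i , eq

-- Fermat's theorem and the number of roots of a polynomial

repunit : ℕ → ℕ → ℕ
repunit q zero = 0
repunit q (suc m) = 1 ℕ.+ q ℕ.* repunit q m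

-- For q ≥ 2, `repunit q m` is (qᵐ - 1) / (q - 1). Writing q as 2 + p makes q - 1 a successor and
-- avoids truncated subtraction.
^-repunit : ∀ p m → suc (suc p) ℕ.^ m ≡ 1 ℕ.+ repunit (suc (suc p)) m ℕ.* suc p
^-repunit p zero = ≡.refl
^-repunit p (suc m) = ≡.trans (≡.cong (suc (suc p) ℕ.*_) (^-repunit p m))
  (solve 2 (λ p g → (con 2 :+ p) :* (con 1 :+ g :* (con 1 :+ p)) :=
                    con 1 :+ (con 1 :+ (con 2 :+ p) :* g) :* (con 1 :+ p)) ≡.refl p (repunit (suc (suc p)) m))
  where open +-*-Solver

module Powers (F : Field) where
  open FieldDefs F hiding (zero)
  open RingSolver commutativeRing
  open SetoidReasoning setoid

  pow-cong : ∀ {x y} m → x ≈ y → pow x m ≈ pow y m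
  pow-cong zero eq = refl
  pow-cong (suc m) eq = *-cong eq (pow-cong m eq)

  pow-+ : ∀ x m k → pow x (m ℕ.+ k) ≈ pow x m * pow x k
  pow-+ x zero k = sym (*-identityˡ _)
  pow-+ x (suc m) k = trans (*-congˡ (pow-+ x m k)) (sym (*-assoc _ _ _))

  pow-* : ∀ x m k → pow x (m ℕ.* k) ≈ pow (pow x k) m
  pow-* x zero k = refl
  pow-* x (suc m) k = trans (pow-+ x k (m ℕ.* k)) (*-congˡ (pow-* x m k))

-- Multiplication by x permutes F; comparing the products of all nonzero
-- elements before and after gives x ^ (N - 1) = 1.
module Fermat (F : Field) (M : ℕ) (card : FieldDefs.HasCard F (suc M)) where
  open FieldDefs F hiding (zero)
  open FieldProperties F
  open Powers F
  open Finite F (suc M) card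
  open CommutativeMonoidSum *-commutativeMonoid using (sum-cong-≋; sum-permute; ∑-distrib-+; sum-remove)
    renaming (sum to product)
  open SetoidReasoning setoid

  -- Replacing the factor at zero by `1#` lets the products run over all indices, so that
  -- multiplication by x acts on them as a permutation.
  unless0 : Carrier → Carrier → Carrier
  unless0 y x with y ≟ 0#
  ... | yes _ = 1#
  ... | no _ = x

  unless0-≈0 : ∀ {y x} → y ≈ 0# → unless0 y x ≈ 1#
  unless0-≈0 {y} y≈0 with y ≟ 0#
  ... | yes _ = refl
  ... | no y≉0 = contradiction y≈0 y≉0

  unless0-≉0 : ∀ {y x} → ¬ y ≈ 0# → unless0 y x ≈ x
  unless0-≉0 {y} y≉0 with y ≟ 0#
  ... | yes y≈0 = contradiction y≈0 y≉0
  ... | no _ = refl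

  product-≉0 : ∀ {k} (f : Fin k → Carrier) → (∀ i → ¬ f i ≈ 0#) → ¬ product f ≈ 0#
  product-≉0 {zero} f _ = 1≉0
  product-≉0 {suc k} f f≉0 = *-≉0 (f≉0 zero) (product-≉0 (f ∘ suc) (f≉0 ∘ suc))

  product-const : ∀ {k x} (f : Fin k → Carrier) → (∀ i → f i ≈ x) → product f ≈ pow x k
  product-const {zero} f _ = refl
  product-const {suc k} f f≈x = *-cong (f≈x zero) (product-const (f ∘ suc) (f≈x ∘ suc))

  fermat : ∀ x → pow x (suc M) ≈ x
  fermat x with x ≟ 0#
  ... | yes x≈0 = trans (*-congʳ x≈0) (trans (zeroˡ _) (sym x≈0))
  ... | no x≉0 = trans (*-congˡ xᴹ≈1) (*-identityʳ x)
    where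
    h k : Fin (suc M) → Carrier
    h i = unless0 (elem i) (elem i)
    k i = unless0 (elem i) x

    times : Carrier → Fin (suc M) → Fin (suc M)
    times z i = index (z * elem i)

    times-inverse : ∀ {z w} → z * w ≈ 1# → ∀ i → times z (times w i) ≡ i
    times-inverse {z} {w} zw≈1 i = elem-injective (begin
      elem (times z (times w i))  ≈⟨ elem-index _ ⟨
      z * elem (times w i)        ≈⟨ *-congˡ (elem-index _) ⟨
      z * (w * elem i)            ≈⟨ *-assoc z w _ ⟨
      z * w * elem i              ≈⟨ *-congʳ zw≈1 ⟩
      1# * elem i                 ≈⟨ *-identityˡ _ ⟩
      elem i                      ∎)

    h-times : ∀ i → h (times x i) ≈ k i * h i
    h-times i with elem i ≟ 0#
    ... | yes e≈0 = trans (unless0-≈0 (trans (sym (elem-index _)) (trans (*-congˡ e≈0) (zeroʳ x))))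
                      (sym (*-identityˡ 1#))
    ... | no e≉0 = trans (unless0-≉0 (≉0-resp (elem-index _) (*-≉0 x≉0 e≉0))) (sym (elem-index _))

    h≉0 : ∀ i → ¬ h i ≈ 0#
    h≉0 i with elem i ≟ 0#
    ... | yes _ = 1≉0
    ... | no e≉0 = e≉0

    product-k : product k ≈ 1#
    product-k = *-cancelʳ (product-≉0 h h≉0) (begin
      product k * product h      ≈⟨ ∑-distrib-+ k h ⟨
      product (λ i → k i * h i)  ≈⟨ sum-cong-≋ h-times ⟨
      product (h ∘ times x)      ≈⟨ sum-permute h (permutation (times x) (times (x ⁻¹))
                                      (times-inverse (⁻¹-inverse x x≉0)) (times-inverse (inverseˡ x≉0))) ⟨
      product h                  ≈⟨ *-identityˡ _ ⟨
      1# * product h             ∎)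

    i₀ : Fin (suc M)
    i₀ = index 0#

    xᴹ≈1 : pow x M ≈ 1#
    xᴹ≈1 = begin
      pow x M                            ≈⟨ product-const _ (λ j → unless0-≉0 λ e≈0 →
                                              Finₚ.punchInᵢ≢i i₀ j (elem-injective (trans e≈0 (elem-index 0#)))) ⟨
      product (k ∘ Fin.punchIn i₀)       ≈⟨ *-identityˡ _ ⟨
      1# * product (k ∘ Fin.punchIn i₀)  ≈⟨ *-congʳ (unless0-≈0 (sym (elem-index 0#))) ⟨
      k i₀ * product (k ∘ Fin.punchIn i₀)  ≈⟨ sum-remove k ⟨
      product k                          ≈⟨ product-k ⟩
      1#                                 ∎

fermat : (F : Field) (N : ℕ) → FieldDefs.HasCard F N → let open FieldDefs F in ∀ x → pow x N ≈ x
fermat F zero card x with () ← Finite.index F 0 card x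
fermat F (suc M) card x = Fermat.fermat F M card x

module Coefficients (F : Field) where
  open FieldDefs F hiding (zero)

  -- Coefficients are listed from the lowest upwards, and only the last must be nonzero. The same
  -- condition serves polynomials in x and operators in σ.
  data TopNonzero : List Carrier → Set where
    [_] : ∀ {a} → ¬ a ≈ 0# → TopNonzero (a ∷ [])
    _∷_ : ∀ a {as} → TopNonzero as → TopNonzero (a ∷ as)

module PolynomialRoots (F : Field) (N : ℕ) (card : FieldDefs.HasCard F N) where
  open FieldDefs F hiding (zero)
  open FieldProperties F
  open RingSolver commutativeRing
  open Powers F
  open Finite F N card
  open Coefficients F
  open SetoidReasoning setoid

  eval : List Carrier → Carrier → Carrier
  eval [] x = 0#
  eval (a ∷ as) x = a + x * eval as x

  -- Synthetic division by x - s: the coefficients are the intermediate values of Horner's scheme at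
  -- s.
  quotient : Carrier → List Carrier → List Carrier
  quotient s [] = []
  quotient s (a ∷ []) = []
  quotient s (a ∷ as@(_ ∷ _)) = eval as s ∷ quotient s as

  eval-quotient : ∀ s as x → eval as x ≈ eval as s + (x - s) * eval (quotient s as) x
  eval-quotient s [] x = solve 2 (λ x s → :0 := :0 :+ (x :- s) :* :0) refl x s
  eval-quotient s (a ∷ []) x =
    solve 3 (λ x s a → a :+ x :* :0 := a :+ s :* :0 :+ (x :- s) :* :0) refl x s a
  eval-quotient s (a ∷ as@(_ ∷ _)) x = trans (+-congˡ (*-congˡ (eval-quotient s as x)))
    (solve 5 (λ x s a e p → a :+ x :* (e :+ (x :- s) :* p) := a :+ s :* e :+ (x :- s) :* (e :+ x :* p))
      refl x s a (eval as s) (eval (quotient s as) x))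

  length-quotient : ∀ s a as → length (quotient s (a ∷ as)) ≡ length as
  length-quotient s a [] = ≡.refl
  length-quotient s a (b ∷ as) = ≡.cong suc (length-quotient s b as)

  quotient-top : ∀ s a {as} → TopNonzero as → TopNonzero (quotient s (a ∷ as))
  quotient-top s a ([_] {b} b≉0) =
    [ b≉0 ∘ trans (solve 2 (λ b s → b := b :+ s :* :0) refl b s) ]
  quotient-top s a (b ∷ top@([ _ ])) = _ ∷ quotient-top s b top
  quotient-top s a (b ∷ top@(_ ∷ _)) = _ ∷ quotient-top s b top

  AtMost-roots : ∀ d as → TopNonzero as → length as ≡ suc d → AtMost (λ x → eval as x ≈ 0#) d
  AtMost-roots zero (a ∷ []) [ a≉0 ] _ =
    (λ x e → contradiction (root⇒ x e) a≉0) , λ p _ _ → contradiction (root⇒ _ p) a≉0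
    where
    root⇒ : ∀ x → a + x * 0# ≈ 0# → a ≈ 0#
    root⇒ x = trans (solve 2 (λ a x → a := a :+ x :* :0) refl a x)
  AtMost-roots (suc d) (a ∷ as) (.a ∷ top) len with search {P = λ s → eval (a ∷ as) s ≈ 0#} resp (λ s → _ ≟ _)
    where
    eval-cong : ∀ as {x y} → x ≈ y → eval as x ≈ eval as y
    eval-cong [] eq = refl
    eval-cong (a ∷ as) eq = +-congˡ (*-cong eq (eval-cong as eq))
    resp : Resp (λ s → eval (a ∷ as) s ≈ 0#)
    resp eq p = trans (eval-cong (a ∷ as) (sym eq)) p
  ... | no ∄ = (λ x e → contradiction (x , e) ∄) , λ {x} p _ _ → contradiction (x , p) ∄
  ... | yes (s , root) = AtMost-∪ (AtMost-singleton s)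
          (AtMost-roots d (quotient s (a ∷ as)) (quotient-top s a top)
            (≡.trans (length-quotient s a as) (ℕₚ.suc-injective len)))
          λ x e → split x (x*y≈0⇒ (begin
            (x - s) * eval (quotient s (a ∷ as)) x                       ≈⟨ +-identityˡ _ ⟨
            0# + (x - s) * eval (quotient s (a ∷ as)) x                  ≈⟨ +-congʳ root ⟨
            eval (a ∷ as) s + (x - s) * eval (quotient s (a ∷ as)) x     ≈⟨ eval-quotient s (a ∷ as) x ⟨
            eval (a ∷ as) x                                              ≈⟨ e ⟩
            0#                                                           ∎))
    where
    split : ∀ x → x - s ≈ 0# ⊎ eval (quotient s (a ∷ as)) x ≈ 0# →
            x ≈ s ⊎ eval (quotient s (a ∷ as)) x ≈ 0#
    split x (inj₁ e) = inj₁ (x-y≈0⇒x≈y e)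
    split x (inj₂ e) = inj₂ e

  module _ (p : ℕ) where
    -- 1 + u + ... + u ^ k with u = x ^ suc p
    geometric : ℕ → List Carrier
    geometric zero = 1# ∷ []
    geometric (suc k) = 1# ∷ (replicate p 0# ++ geometric k)

    eval-shift : ∀ m as x → eval (replicate m 0# ++ as) x ≈ pow x m * eval as x
    eval-shift zero as x = sym (*-identityˡ _)
    eval-shift (suc m) as x = begin
      0# + x * eval (replicate m 0# ++ as) x  ≈⟨ +-identityˡ _ ⟩
      x * eval (replicate m 0# ++ as) x       ≈⟨ *-congˡ (eval-shift m as x) ⟩
      x * (pow x m * eval as x)               ≈⟨ *-assoc _ _ _ ⟨
      x * pow x m * eval as x                 ∎

    geometric-sum : ∀ k x → (pow x (suc p) - 1#) * eval (geometric k) x ≈ pow (pow x (suc p)) (suc k) - 1#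
    geometric-sum zero x =
      solve 2 (λ x u → (u :- :1) :* (:1 :+ x :* :0) := u :* :1 :- :1) refl x (pow x (suc p))
    geometric-sum (suc k) x = begin
      (u - 1#) * (1# + x * eval (replicate p 0# ++ geometric k) x)  ≈⟨ *-congˡ (+-congˡ (*-congˡ (eval-shift p _ x))) ⟩
      (u - 1#) * (1# + x * (pow x p * g))                           ≈⟨ solve 3 (λ x v g →
        (x :* v :- :1) :* (:1 :+ x :* (v :* g)) := (x :* v :- :1) :+ x :* v :* ((x :* v :- :1) :* g)) refl x (pow x p) g ⟩
      (u - 1#) + u * ((u - 1#) * g)                                 ≈⟨ +-congˡ (*-congˡ (geometric-sum k x)) ⟩
      (u - 1#) + u * (pow u (suc k) - 1#)                           ≈⟨ solve 2 (λ u v →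
        (u :- :1) :+ u :* (v :- :1) := u :* v :- :1) refl u (pow u (suc k)) ⟩
      pow u (suc (suc k)) - 1#                                      ∎
      where
      u = pow x (suc p)
      g = eval (geometric k) x

    geometric-length : ∀ k → length (geometric k) ≡ suc (k ℕ.* suc p)
    geometric-length zero = ≡.refl
    geometric-length (suc k) = ≡.cong suc (≡.trans (Listₚ.length-++ (replicate p 0#))
      (≡.trans (≡.cong₂ ℕ._+_ (Listₚ.length-replicate p) (geometric-length k)) (ℕₚ.+-suc p _)))

    shift-top : ∀ m {as} → TopNonzero as → TopNonzero (replicate m 0# ++ as)
    shift-top zero top = top
    shift-top (suc m) top = 0# ∷ shift-top m top

    geometric-top : ∀ k → TopNonzero (geometric k)
    geometric-top zero = [ 1≉0 ]
    geometric-top (suc k) = 1# ∷ shift-top p (geometric-top k)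

  -- The nonzero x with x ^ q ≠ x are roots of (x ^ (q ^ n - 1) - 1) / (x ^ (q - 1) - 1).
  frobenius-fixed-≥ : ∀ p n → let q = suc (suc p) in N ≡ q ℕ.^ suc n →
                      ∀ {c} → HasExactly (λ x → pow x q ≈ x) c → q ≤ c
  frobenius-fixed-≥ p n N≡qⁿ {c} exact = ℕₚ.+-cancelʳ-≤ (k ℕ.* suc p) q c
    (≡.subst (_≤ c ℕ.+ k ℕ.* suc p) size (AtMost⇒≤ all elem (λ _ → tt) (λ _ _ → elem-injective)))
    where
    q = suc (suc p)
    -- `suc k` is (N - 1) / (q - 1), so `geometric p k` has degree k (q - 1) = N - q and at least q
    -- elements remain for the other factor.
    k = q ℕ.* repunit q n
    size : N ≡ q ℕ.+ k ℕ.* suc p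
    size = ≡.trans N≡qⁿ (^-repunit p (suc n))
    all : AtMost (λ _ → ⊤) (c ℕ.+ k ℕ.* suc p)
    all = AtMost-∪ (HasExactly⇒AtMost exact)
      (AtMost-roots (k ℕ.* suc p) (geometric p k) (geometric-top p k) (geometric-length p k)) λ x _ → cover x
      where
      cover : ∀ x → pow x q ≈ x ⊎ eval (geometric p k) x ≈ 0#
      cover x with pow x q ≟ x
      ... | yes fixed = inj₁ fixed
      ... | no ¬fixed = inj₂ (x*y≈0⇒y≈0 u-1≉0 (trans (geometric-sum p k x) (x≈y⇒x-y≈0 u^≈1)))
        where
        x≉0 : ¬ x ≈ 0#
        x≉0 x≈0 = ¬fixed (trans (*-congʳ x≈0) (trans (zeroˡ _) (sym x≈0)))
        u = pow x (suc p)
        u-1≉0 : ¬ u - 1# ≈ 0#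
        u-1≉0 e = ¬fixed (trans (*-congˡ (x-y≈0⇒x≈y e)) (*-identityʳ x))
        u^≈1 : pow u (suc k) ≈ 1#
        u^≈1 = *-cancelˡ x≉0 (begin
          x * pow u (suc k)                ≈⟨ *-congˡ (pow-* x (suc k) (suc p)) ⟨
          pow x (suc (suc k ℕ.* suc p))    ≡⟨ ≡.cong (pow x) size ⟨
          pow x N                          ≈⟨ fermat F N card x ⟩
          x                                ≈⟨ *-identityʳ x ⟨
          x * 1#                           ∎)

-- Operators in σ and independence over Fix σ

funToFin-cong : ∀ {m n} {f g : Fin m → Fin n} → (∀ i → f i ≡ g i) → Fin.funToFin f ≡ Fin.funToFin g
funToFin-cong {zero} f≗g = ≡.refl
funToFin-cong {suc m} f≗g = ≡.cong₂ Fin.combine (f≗g zero) (funToFin-cong (f≗g ∘ suc))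

finToFun-injective : ∀ {m n} {i j : Fin (n ℕ.^ m)} →
                     (∀ k → Fin.finToFun {n} {m} i k ≡ Fin.finToFun j k) → i ≡ j
finToFun-injective {m} {n} {i} {j} eq =
  ≡.trans (≡.sym (Finₚ.funToFin-finToFin {m} {n} i))
    (≡.trans (funToFin-cong eq) (Finₚ.funToFin-finToFin {m} {n} j))

primePower-≥2 : ∀ {q} → IsPrimePower q → 2 ≤ q
primePower-≥2 (suc (suc p) , suc k , _ , _ , ≡.refl) =
  ℕₚ.≤-trans (s≤s (s≤s z≤n)) (ℕₚ.m≤m*n (suc (suc p)) (suc (suc p) ℕ.^ k) {{ℕₚ.m^n≢0 (suc (suc p)) k}})
primePower-≥2 (0 , _ , p-prime , _) = contradiction (prime⇒nonTrivial p-prime) λ ()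
primePower-≥2 (1 , _ , p-prime , _) = contradiction (prime⇒nonTrivial p-prime) λ ()

module Automorphism (F : Field) (q n : ℕ) (σ : Field.Carrier F → Field.Carrier F)
                    (gen : FieldDefs.IsGaloisGenerator F q n σ) where
  open FieldDefs F hiding (zero)
  open FieldProperties F
  open RingSolver commutativeRing
  open Coefficients F
  open IsGaloisGenerator gen public
  open SetoidReasoning setoid

  σ-0 : σ 0# ≈ 0#
  σ-0 = begin
    σ 0#                  ≈⟨ solve 1 (λ x → x := (x :+ x) :- x) refl _ ⟩
    σ 0# + σ 0# - σ 0#    ≈⟨ +-congʳ (σ-+ 0# 0#) ⟨
    σ (0# + 0#) - σ 0#    ≈⟨ +-congʳ (cong-σ (+-identityʳ 0#)) ⟩
    σ 0# - σ 0#           ≈⟨ -‿inverseʳ _ ⟩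
    0#                    ∎

  σ-neg : ∀ x → σ (- x) ≈ - σ x
  σ-neg x = begin
    σ (- x)                ≈⟨ solve 2 (λ x y → y := (x :+ y) :- x) refl (σ x) _ ⟩
    σ x + σ (- x) - σ x    ≈⟨ +-congʳ (σ-+ x (- x)) ⟨
    σ (x - x) - σ x        ≈⟨ +-congʳ (trans (cong-σ (-‿inverseʳ x)) σ-0) ⟩
    0# - σ x               ≈⟨ +-identityˡ _ ⟩
    - σ x                  ∎

  σ-sub : ∀ x y → σ (x - y) ≈ σ x - σ y
  σ-sub x y = trans (σ-+ x (- y)) (+-congˡ (σ-neg y))

  σ≈0⇒≈0 : ∀ {x} → σ x ≈ 0# → x ≈ 0#
  σ≈0⇒≈0 e = σ-inj _ _ (trans e (sym σ-0))

  σ-⁻¹ : ∀ {x} → ¬ x ≈ 0# → σ x * σ (x ⁻¹) ≈ 1#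
  σ-⁻¹ {x} x≉0 = trans (sym (σ-* x (x ⁻¹))) (trans (cong-σ (⁻¹-inverse x x≉0)) σ-1)

  iter-cong : ∀ j {x y} → x ≈ y → iter σ j x ≈ iter σ j y
  iter-cong zero eq = eq
  iter-cong (suc j) eq = cong-σ (iter-cong j eq)

  iter-* : ∀ j x y → iter σ j (x * y) ≈ iter σ j x * iter σ j y
  iter-* zero x y = refl
  iter-* (suc j) x y = trans (cong-σ (iter-* j x y)) (σ-* _ _)

  iter-σ : ∀ j x → iter σ j (σ x) ≡ σ (iter σ j x)
  iter-σ zero x = ≡.refl
  iter-σ (suc j) x = ≡.cong σ (iter-σ j x)

  iter-≉0 : ∀ j {x} → ¬ x ≈ 0# → ¬ iter σ j x ≈ 0#
  iter-≉0 zero x≉0 = x≉0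
  iter-≉0 (suc j) x≉0 = iter-≉0 j x≉0 ∘ σ≈0⇒≈0

  Fixed : Carrier → Set
  Fixed x = σ x ≈ x

  fixed-resp : ∀ {x y} → x ≈ y → Fixed x → Fixed y
  fixed-resp eq fx = trans (cong-σ (sym eq)) (trans fx eq)

  fixed-* : ∀ {x y} → Fixed x → Fixed y → Fixed (x * y)
  fixed-* fx fy = trans (σ-* _ _) (*-cong fx fy)

  fixed-sub : ∀ {x y} → Fixed x → Fixed y → Fixed (x - y)
  fixed-sub fx fy = trans (σ-sub _ _) (+-cong fx (-‿cong fy))

  fixed-iter : ∀ j {x} → Fixed x → iter σ j x ≈ x
  fixed-iter zero fx = refl
  fixed-iter (suc j) fx = trans (cong-σ (fixed-iter j fx)) fx

  -- a₀ + a₁ σ + a₂ σ² + ... as an operator on F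
  apply : List Carrier → Carrier → Carrier
  apply [] y = 0#
  apply (a ∷ as) y = a * y + apply as (σ y)

  apply-cong : ∀ as {x y} → x ≈ y → apply as x ≈ apply as y
  apply-cong [] eq = refl
  apply-cong (a ∷ as) eq = +-cong (*-congˡ eq) (apply-cong as (cong-σ eq))

  apply-+ : ∀ as x y → apply as (x + y) ≈ apply as x + apply as y
  apply-+ [] x y = sym (+-identityʳ 0#)
  apply-+ (a ∷ as) x y = trans (+-congˡ (trans (apply-cong as (σ-+ x y)) (apply-+ as _ _)))
    (solve 5 (λ a x y p r → a :* (x :+ y) :+ (p :+ r) := a :* x :+ p :+ (a :* y :+ r)) refl a x y _ _)

  apply-scale : ∀ as {c} → Fixed c → ∀ x → apply as (c * x) ≈ c * apply as x
  apply-scale [] {c} fc x = sym (zeroʳ c)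
  apply-scale (a ∷ as) {c} fc x = trans
    (+-congˡ (trans (apply-cong as (trans (σ-* c x) (*-congʳ fc))) (apply-scale as fc (σ x))))
    (solve 4 (λ a c x p → a :* (c :* x) :+ c :* p := c :* (a :* x :+ p)) refl a c x _)

  -- Coefficients of p + (σ - c) A. The argument `p` carries σ of the previous coefficient of A,
  -- which moves up by one degree.
  compose : Carrier → Carrier → List Carrier → List Carrier
  compose c p [] = p ∷ []
  compose c p (a ∷ as) = (p - c * a) ∷ compose c (σ a) as

  apply-compose : ∀ c p as y → apply (compose c p as) y ≈ p * y + (σ (apply as y) - c * apply as y)
  apply-compose c p [] y = trans
    (solve 3 (λ c p y → p :* y :+ :0 := p :* y :+ (:0 :- c :* :0)) refl c p y)
    (+-congˡ (+-congʳ (sym σ-0)))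
  apply-compose c p (a ∷ as) y = begin
    (p - c * a) * y + apply (compose c (σ a) as) (σ y)  ≈⟨ +-congˡ (apply-compose c (σ a) as (σ y)) ⟩
    (p - c * a) * y + (σ a * σ y + (σ v - c * v))       ≈⟨ solve 7 (λ p c a y a′y′ v′ v →
      (p :- c :* a) :* y :+ (a′y′ :+ (v′ :- c :* v)) := p :* y :+ ((a′y′ :+ v′) :- c :* (a :* y :+ v)))
      refl p c a y (σ a * σ y) (σ v) v ⟩
    p * y + ((σ a * σ y + σ v) - c * (a * y + v))       ≈⟨ +-congˡ (+-congʳ
      (trans (σ-+ _ _) (+-congʳ (σ-* a y)))) ⟨
    p * y + (σ (a * y + v) - c * (a * y + v))           ∎
    where v = apply as (σ y)

  length-compose : ∀ c p as → length (compose c p as) ≡ suc (length as)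
  length-compose c p [] = ≡.refl
  length-compose c p (a ∷ as) = ≡.cong suc (length-compose c (σ a) as)

  compose-top : ∀ c p {as} → TopNonzero as → TopNonzero (compose c p as)
  compose-top c p [ a≉0 ] = _ ∷ [ a≉0 ∘ σ≈0⇒≈0 ]
  compose-top c p (a ∷ top) = _ ∷ compose-top c (σ a) top

  -- The commutator with multiplication by x multiplies the coefficient of σʲ by σʲ(x) - x. The
  -- constant term commutes with x, so the twist is later taken from j = 1.
  twist : Carrier → ℕ → List Carrier → List Carrier
  twist x j [] = []
  twist x j (b ∷ bs) = b * (iter σ j x - x) ∷ twist x (suc j) bs

  length-twist : ∀ x j bs → length (twist x j bs) ≡ length bs
  length-twist x j [] = ≡.refl
  length-twist x j (b ∷ bs) = ≡.cong suc (length-twist x (suc j) bs)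

  apply-twist : ∀ x j bs y → apply (twist x j bs) y ≈ apply bs (iter σ j x * y) - x * apply bs y
  apply-twist x j [] y = solve 1 (λ x → :0 := :0 :- x :* :0) refl x
  apply-twist x j (b ∷ bs) y = begin
    b * (iter σ j x - x) * y + apply (twist x (suc j) bs) (σ y)  ≈⟨ +-congˡ (apply-twist x (suc j) bs (σ y)) ⟩
    b * (iter σ j x - x) * y + (apply bs (σ (iter σ j x) * σ y) - x * apply bs (σ y))
      ≈⟨ solve 6 (λ b s x y p r → b :* (s :- x) :* y :+ (p :- x :* r) := b :* (s :* y) :+ p :- x :* (b :* y :+ r))
           refl b (iter σ j x) x y _ _ ⟩
    b * (iter σ j x * y) + apply bs (σ (iter σ j x) * σ y) - x * (b * y + apply bs (σ y))
      ≈⟨ +-congʳ (+-congˡ (apply-cong bs (σ-* _ y))) ⟨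
    b * (iter σ j x * y) + apply bs (σ (iter σ j x * y)) - x * (b * y + apply bs (σ y))  ∎

  twist-top : ∀ x j {bs l} → TopNonzero bs → length bs ≡ suc l → ¬ iter σ (j ℕ.+ l) x ≈ x →
              TopNonzero (twist x j bs)
  twist-top x j {l = zero} [ b≉0 ] len moved rewrite ℕₚ.+-identityʳ j = [ *-≉0 b≉0 (≉⇒-≉0 moved) ]
  twist-top x j {l = suc l} (b ∷ top) len moved rewrite ℕₚ.+-suc j l =
    _ ∷ twist-top x (suc j) top (ℕₚ.suc-injective len) moved
  twist-top x j {l = zero} (b ∷ [ _ ]) ()
  twist-top x j {l = zero} (b ∷ (_ ∷ _)) ()

  combine : ∀ {k} → (Fin k → Carrier) → (Fin k → Carrier) → Carrier
  combine {zero} α t = 0#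
  combine {suc k} α t = α zero * t zero + combine (α ∘ suc) (t ∘ suc)

  combine-sub : ∀ {k} (α β t : Fin k → Carrier) →
                combine (λ i → α i - β i) t ≈ combine α t - combine β t
  combine-sub {zero} α β t = sym (-‿inverseʳ 0#)
  combine-sub {suc k} α β t = trans (+-congˡ (combine-sub (α ∘ suc) (β ∘ suc) (t ∘ suc)))
    (solve 5 (λ a b t p r → (a :- b) :* t :+ (p :- r) := a :* t :+ p :- (b :* t :+ r)) refl _ _ _ _ _)

  combine-scale : ∀ {k} c (α t : Fin k → Carrier) → combine (λ i → c * α i) t ≈ c * combine α t
  combine-scale {zero} c α t = sym (zeroʳ c)
  combine-scale {suc k} c α t = trans (+-congˡ (combine-scale c (α ∘ suc) (t ∘ suc)))
    (solve 4 (λ c a t p → c :* a :* t :+ c :* p := c :* (a :* t :+ p)) refl _ _ _ _)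

  -- The bound `m` on the order is kept separate from n: it is used with m = n, and with m = n + 1
  -- to refute σⁿ ≠ id.
  module Independence (card : HasCard (q ℕ.^ n)) (m : ℕ)
                      (order : ∀ j → 0 < j → j < m → ∃ λ x → ¬ iter σ j x ≈ x) where
    open Finite F (q ℕ.^ n) card

    -- The commutator of an operator with multiplication by x has one term fewer.
    dedekind : ∀ k {as} → TopNonzero as → length as ≡ suc k → k < m → ∃ λ y → ¬ apply as y ≈ 0#
    dedekind zero {a ∷ []} [ a≉0 ] _ _ =
      1# , a≉0 ∘ trans (solve 1 (λ a → a := a :* :1 :+ :0) refl a)
    dedekind zero (_ ∷ [ _ ]) ()
    dedekind zero (_ ∷ (_ ∷ _)) ()
    dedekind (suc k) {a ∷ bs} (.a ∷ top) len k<m with order (suc k) (s≤s z≤n) k<m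
    ... | x , moved with dedekind k (twist-top x 1 top (ℕₚ.suc-injective len) moved)
                           (≡.trans (length-twist x 1 bs) (ℕₚ.suc-injective len)) (ℕₚ.<-trans (ℕₚ.n<1+n k) k<m)
    -- The twisted list begins with the coefficient of σ, so its argument has to be written as σ(y).
    -- If y and x y were both annihilated, the twisted operator would vanish at z.
    ...   | z , z-works with σ-surj z
    ...     | y , σy≈z with apply (a ∷ bs) y ≟ 0#
    ...       | no ≉0 = y , ≉0
    ...       | yes ≈0 = x * y , λ ≈0′ → z-works (begin
      apply (twist x 1 bs) z                                              ≈⟨ apply-cong (twist x 1 bs) σy≈z ⟨
      apply (twist x 1 bs) (σ y)                                          ≈⟨ apply-twist x 1 bs (σ y) ⟩
      apply bs (σ x * σ y) - x * apply bs (σ y)                           ≈⟨ +-congʳ (apply-cong bs (σ-* x y)) ⟨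
      apply bs (σ (x * y)) - x * apply bs (σ y)                           ≈⟨ solve 5 (λ a x y p r →
        p :- x :* r := (a :* (x :* y) :+ p) :- x :* (a :* y :+ r)) refl a x y _ _ ⟩
      apply (a ∷ bs) (x * y) - x * apply (a ∷ bs) y                       ≈⟨ +-cong ≈0′ (-‿cong (*-congˡ ≈0)) ⟩
      0# - x * 0#                                                         ≈⟨ solve 1 (λ x → :0 :- x :* :0 := :0) refl x ⟩
      0#                                                                  ∎)

    -- With c = σ(v) / v for a value v of the operator A at t, the operator
    -- (σ - c) A is again nonzero and annihilates t.
    independent-values : ∀ k {as} → TopNonzero as → length as ℕ.+ k ≤ suc m →
      Σ (Fin k → Carrier) λ t → ∀ α → (∀ i → Fixed (α i)) → apply as (combine α t) ≈ 0# → ∀ i → α i ≈ 0#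
    independent-values zero top bound = (λ ()) , λ _ _ _ ()
    independent-values (suc k) {as@(_ ∷ as′)} top bound
      with dedekind (length as′) top ≡.refl
             (ℕₚ.≤-trans (ℕₚ.m≤m+n _ k) (ℕ.s≤s⁻¹ (≡.subst (_≤ suc m) (ℕₚ.+-suc (length as) k) bound)))
    -- Composition with σ - c adds one term while one value fewer remains to be found, so the sum in
    -- the length bound is unchanged.
    ... | t₀ , v≉0 with independent-values k (compose-top c 0# top)
                          (≡.subst (_≤ suc m) (≡.trans (ℕₚ.+-suc (length as) k)
                            (≡.cong (ℕ._+ k) (≡.sym (length-compose c 0# as)))) bound)
      where c = σ (apply as t₀) * apply as t₀ ⁻¹
    ...   | t , t-indep = t′ , indep
      where
      v = apply as t₀
      c = σ v * v ⁻¹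
      t′ : Fin (suc k) → Carrier
      t′ zero = t₀
      t′ (suc i) = t i
      indep : ∀ α → (∀ i → Fixed (α i)) → apply as (combine α t′) ≈ 0# → ∀ i → α i ≈ 0#
      indep α fα ≈0 = λ { zero → α₀≈0 ; (suc i) → rest i }
        where
        r = combine (α ∘ suc) t
        expand : α zero * v + apply as r ≈ 0#
        expand = trans (+-congʳ (sym (apply-scale as (fα zero) t₀))) (trans (sym (apply-+ as _ _)) ≈0)
        σ-expand : α zero * σ v + σ (apply as r) ≈ 0#
        σ-expand = begin
          α zero * σ v + σ (apply as r)  ≈⟨ +-congʳ (trans (σ-* _ v) (*-congʳ (fα zero))) ⟨
          σ (α zero * v) + σ (apply as r)  ≈⟨ σ-+ _ _ ⟨
          σ (α zero * v + apply as r)    ≈⟨ cong-σ expand ⟩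
          σ 0#                           ≈⟨ σ-0 ⟩
          0#                             ∎
        rest : ∀ i → α (suc i) ≈ 0#
        rest = t-indep (α ∘ suc) (fα ∘ suc) (begin
          apply (compose c 0# as) r                                        ≈⟨ apply-compose c 0# as r ⟩
          0# * r + (σ (apply as r) - c * apply as r)                       ≈⟨ solve 7 (λ r w′ c w a v v′ →
            :0 :* r :+ (w′ :- c :* w) := (a :* v′ :+ w′) :- c :* (a :* v :+ w) :- a :* (v′ :- c :* v))
            refl r (σ (apply as r)) c (apply as r) (α zero) v (σ v) ⟩
          (α zero * σ v + σ (apply as r)) - c * (α zero * v + apply as r) - α zero * (σ v - c * v)
            ≈⟨ +-cong (+-cong σ-expand (-‿cong (*-congˡ expand))) (-‿cong (*-congˡ (+-congˡ (-‿cong (/-cancel v≉0))))) ⟩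
          0# - c * 0# - α zero * (σ v - σ v)  ≈⟨ solve 3 (λ c a s → :0 :- c :* :0 :- a :* (s :- s) := :0) refl _ _ _ ⟩
          0#                                  ∎)
        r≈0 : ∀ {k} (β s : Fin k → Carrier) → (∀ i → β i ≈ 0#) → combine β s ≈ 0#
        r≈0 {zero} β s _ = refl
        r≈0 {suc k} β s β≈0 = trans (+-cong (trans (*-congʳ (β≈0 zero)) (zeroˡ _)) (r≈0 _ _ (β≈0 ∘ suc))) (+-identityʳ 0#)
        apply-0 : ∀ as → apply as 0# ≈ 0#
        apply-0 as = trans (apply-cong as (sym (zeroˡ 0#))) (trans (apply-scale as σ-0 0#) (zeroˡ _))
        α₀≈0 : α zero ≈ 0#
        α₀≈0 = x*y≈0⇒x≈0 v≉0 (begin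
          α zero * v                ≈⟨ +-identityʳ _ ⟨
          α zero * v + 0#           ≈⟨ +-congˡ (trans (apply-cong as (r≈0 (α ∘ suc) t rest)) (apply-0 as)) ⟨
          α zero * v + apply as r   ≈⟨ expand ⟩
          0#                        ∎)

    -- For the identity operator, independent values are m elements of F independent over Fix σ;
    -- their Qᵐ combinations are distinct.
    fixed-^-≤ : ∀ {Q} → HasExactly Fixed Q → Q ℕ.^ m ≤ q ℕ.^ n
    fixed-^-≤ {Q} (κ , κ-inj , κ-fixed , _) with independent-values m {1# ∷ []} [ 1≉0 ] ℕₚ.≤-refl
    ... | t , t-indep = AtMost⇒≤ AtMost-⊤ point (λ _ → tt) point-injective
      where
      coords : Fin (Q ℕ.^ m) → Fin m → Carrier
      coords i j = κ (Fin.finToFun i j)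
      point : Fin (Q ℕ.^ m) → Carrier
      point i = combine (coords i) t
      point-injective : ∀ i j → point i ≈ point j → i ≡ j
      point-injective i j eq = finToFun-injective {m} {Q} λ k → κ-inj _ _ (x-y≈0⇒x≈y
        (t-indep (λ k → coords i k - coords j k) (λ k → fixed-sub (κ-fixed _) (κ-fixed _))
          (begin
            1# * combine (λ k → coords i k - coords j k) t + 0#  ≈⟨ solve 1 (λ x → :1 :* x :+ :0 := x) refl _ ⟩
            combine (λ k → coords i k - coords j k) t            ≈⟨ combine-sub (coords i) (coords j) t ⟩
            point i - point j                                    ≈⟨ x≈y⇒x-y≈0 eq ⟩
            0#                                                   ∎) k))

module Galois (F : Field) (q n : ℕ) (2≤q : 2 ≤ q) (1≤n : 1 ≤ n) (card : FieldDefs.HasCard F (q ℕ.^ n))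
              (σ : Field.Carrier F → Field.Carrier F) (gen : FieldDefs.IsGaloisGenerator F q n σ) where
  open FieldDefs F hiding (zero)
  open FieldProperties F
  open RingSolver commutativeRing
  open Coefficients F
  open Powers F
  open Finite F (q ℕ.^ n) card
  open Automorphism F q n σ gen
  open Independence card n σ-order using (dedekind; independent-values; fixed-^-≤) public
  open SetoidReasoning setoid

  private
    abstract
      fixed-count : ∃ (HasExactly Fixed)
      fixed-count = count fixed-resp (λ x → σ x ≟ x)

      frobenius-count : ∃ (HasExactly (λ x → pow x q ≈ x))
      frobenius-count = count (λ eq p → trans (pow-cong q (sym eq)) (trans p eq)) (λ x → pow x q ≟ x)

    Q = proj₁ fixed-count
    c = proj₁ frobenius-count

    q≤c : q ≤ c
    q≤c = go 2≤q 1≤n ≡.refl (proj₂ frobenius-count)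
      where
      go : ∀ {q′ n′ c} → 2 ≤ q′ → 1 ≤ n′ → q ℕ.^ n ≡ q′ ℕ.^ n′ → HasExactly (λ x → pow x q′ ≈ x) c → q′ ≤ c
      go {suc (suc p)} {suc m} (s≤s (s≤s z≤n)) (s≤s z≤n) eq = PolynomialRoots.frobenius-fixed-≥ F (q ℕ.^ n) card p m eq

    ^-cancel-≤ : ∀ {a b} → a ℕ.^ n ≤ b ℕ.^ n → a ≤ b
    ^-cancel-≤ {a} {b} aⁿ≤bⁿ with a ℕ.≤? b
    ... | yes a≤b = a≤b
    ... | no a≰b = contradiction aⁿ≤bⁿ (ℕₚ.<⇒≱ (ℕₚ.^-monoˡ-< n {{ℕ.>-nonZero 1≤n}} (ℕₚ.≰⇒> a≰b)))

    Q≤q : Q ≤ q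
    Q≤q = ^-cancel-≤ (fixed-^-≤ (proj₂ fixed-count))

    c≤Q : c ≤ Q
    c≤Q with proj₂ frobenius-count
    ... | r , r-inj , r-frob , _ =
      AtMost⇒≤ (HasExactly⇒AtMost (proj₂ fixed-count)) r (λ i → σ-fixes-Fq _ (r-frob i)) r-inj

    -- The chain q ≤ c ≤ Q ≤ q: solutions of x^q = x are numerous enough, σ fixes them, and Qⁿ ≤ qⁿ.
    Q≡q : Q ≡ q
    Q≡q = ℕₚ.≤-antisym Q≤q (ℕₚ.≤-trans q≤c c≤Q)

  fixed-exactly : HasExactly Fixed q
  fixed-exactly = ≡.subst (HasExactly Fixed) Q≡q (proj₂ fixed-count)

  -- At least q solutions of x^q = x lie among the q elements fixed by σ, hence exhaust them.
  fixed⇒frobenius-fixed : ∀ {x} → Fixed x → pow x q ≈ x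
  fixed⇒frobenius-fixed {x} fx = go (proj₂ frobenius-count) q≤c
    where
    go : ∀ {c} → HasExactly (λ x → pow x q ≈ x) c → q ≤ c → pow x q ≈ x
    go (r , r-inj , r-frob , _) q≤c =
      let i , x≈r = AtMost⇒complete (AtMost-mono q≤c (HasExactly⇒AtMost fixed-exactly))
                      r (λ i → σ-fixes-Fq _ (r-frob i)) r-inj x fx
      in trans (pow-cong q x≈r) (trans (r-frob i) (sym x≈r))

  -- If σⁿ were not the identity, 1, σ, ..., σⁿ would be independent, whence q ^ (n + 1) ≤ q ^ n.
  σⁿ≈id : ∀ x → iter σ n x ≈ x
  σⁿ≈id with every {P = λ x → iter σ n x ≈ x} (λ eq p → trans (iter-cong n (sym eq)) (trans p eq)) (λ x → iter σ n x ≟ x)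
  ... | inj₂ id = id
  ... | inj₁ moved = contradiction
      (ℕₚ.≤-trans (ℕₚ.^-monoˡ-≤ (suc n) (ℕₚ.≤-trans q≤c c≤Q)) (Independence.fixed-^-≤ card (suc n) order (proj₂ fixed-count)))
      (ℕₚ.<⇒≱ (ℕₚ.^-monoʳ-< q 2≤q (ℕₚ.n<1+n n)))
    where
    order : ∀ j → 0 < j → j < suc n → ∃ λ x → ¬ iter σ j x ≈ x
    order j 0<j j<1+n with ℕₚ.m≤n⇒m<n∨m≡n (ℕ.s≤s⁻¹ j<1+n)
    ... | inj₁ j<n = σ-order j 0<j j<n
    ... | inj₂ ≡.refl = moved

  N : ℕ → Carrier → Carrier
  N zero y = 1#
  N (suc k) y = y * σ (N k y)

  N-cong : ∀ k {x y} → x ≈ y → N k x ≈ N k y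
  N-cong zero eq = refl
  N-cong (suc k) eq = *-cong eq (cong-σ (N-cong k eq))

  N-* : ∀ k x y → N k (x * y) ≈ N k x * N k y
  N-* zero x y = sym (*-identityˡ 1#)
  N-* (suc k) x y = trans (*-congˡ (trans (cong-σ (N-* k x y)) (σ-* _ _)))
    (solve 4 (λ x y p r → x :* y :* (p :* r) := x :* p :* (y :* r)) refl x y _ _)

  N-snoc : ∀ k y → N (suc k) y ≈ N k y * iter σ k y
  N-snoc zero y = trans (*-congˡ σ-1) (*-comm y 1#)
  N-snoc (suc k) y = begin
    y * σ (y * σ (N k y))             ≈⟨ *-congˡ (cong-σ (N-snoc k y)) ⟩
    y * σ (N k y * iter σ k y)        ≈⟨ *-congˡ (σ-* _ _) ⟩
    y * (σ (N k y) * σ (iter σ k y))  ≈⟨ *-assoc _ _ _ ⟨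
    y * σ (N k y) * σ (iter σ k y)    ∎

  N-≉0 : ∀ k {y} → ¬ y ≈ 0# → ¬ N k y ≈ 0#
  N-≉0 zero _ = 1≉0
  N-≉0 (suc k) y≉0 = *-≉0 y≉0 (N-≉0 k y≉0 ∘ σ≈0⇒≈0)

  norm : Carrier → Carrier
  norm = N n

  norm-snoc : ∀ y → N (suc n) y ≈ norm y * y
  norm-snoc y = trans (N-snoc n y) (*-congˡ (σⁿ≈id y))

  -- The product of n + 1 conjugates is y σ(norm y) when split at the front and norm y · y when
  -- split at the back.
  norm-fixed : ∀ {y} → ¬ y ≈ 0# → Fixed (norm y)
  norm-fixed {y} y≉0 = *-cancelˡ y≉0 (trans (norm-snoc y) (*-comm _ y))

  norm-/ : ∀ {x y} → ¬ y ≈ 0# → norm x ≈ norm y → norm (x * y ⁻¹) ≈ 1#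
  norm-/ {x} {y} y≉0 eq = *-cancelʳ (N-≉0 n y≉0) (begin
    norm (x * y ⁻¹) * norm y  ≈⟨ N-* n _ _ ⟨
    norm (x * y ⁻¹ * y)       ≈⟨ N-cong n (/-cancel y≉0) ⟩
    norm x                    ≈⟨ eq ⟩
    norm y                    ≈⟨ *-identityˡ _ ⟨
    1# * norm y               ∎)

  -- coefficients of the operator t ↦ t + x σ(t) + x σ(x) σ²(t) + ... with k terms
  resolvent : Carrier → ℕ → List Carrier
  resolvent x zero = []
  resolvent x (suc k) = 1# ∷ map (λ a → x * σ a) (resolvent x k)

  apply-map : ∀ x as t → apply (map (λ a → x * σ a) as) (σ t) ≈ x * σ (apply as t)
  apply-map x [] t = sym (trans (*-congˡ σ-0) (zeroʳ x))
  apply-map x (a ∷ as) t = begin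
    x * σ a * σ t + apply (map (λ a → x * σ a) as) (σ (σ t))  ≈⟨ +-congˡ (apply-map x as (σ t)) ⟩
    x * σ a * σ t + x * σ (apply as (σ t))                    ≈⟨ solve 4 (λ x a t p →
      x :* a :* t :+ x :* p := x :* (a :* t :+ p)) refl x (σ a) (σ t) _ ⟩
    x * (σ a * σ t + σ (apply as (σ t)))                      ≈⟨ *-congˡ (trans (σ-+ _ _) (+-congʳ (σ-* a t))) ⟨
    x * σ (a * t + apply as (σ t))                            ∎

  resolvent-step : ∀ x k t → apply (resolvent x (suc k)) t ≈ t + x * σ (apply (resolvent x k) t)
  resolvent-step x k t = +-cong (*-identityˡ t) (apply-map x (resolvent x k) t)

  resolvent-snoc : ∀ x k t → apply (resolvent x (suc k)) t ≈ apply (resolvent x k) t + N k x * iter σ k t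
  resolvent-snoc x zero t = trans (+-identityʳ _) (sym (+-identityˡ _))
  resolvent-snoc x (suc k) t = begin
    apply (resolvent x (suc (suc k))) t                                ≈⟨ resolvent-step x (suc k) t ⟩
    t + x * σ (apply (resolvent x (suc k)) t)                          ≈⟨ +-congˡ (*-congˡ (cong-σ (resolvent-snoc x k t))) ⟩
    t + x * σ (apply (resolvent x k) t + N k x * iter σ k t)           ≈⟨ +-congˡ (*-congˡ (trans (σ-+ _ _) (+-congˡ (σ-* _ _)))) ⟩
    t + x * (σ (apply (resolvent x k) t) + σ (N k x) * σ (iter σ k t)) ≈⟨ solve 5 (λ t x p r s →
      t :+ x :* (p :+ r :* s) := t :+ x :* p :+ x :* r :* s) refl t x _ _ _ ⟩
    t + x * σ (apply (resolvent x k) t) + N (suc k) x * iter σ (suc k) t  ≈⟨ +-congʳ (resolvent-step x k t) ⟨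
    apply (resolvent x (suc k)) t + N (suc k) x * iter σ (suc k) t     ∎

  map-top : ∀ {x} → ¬ x ≈ 0# → ∀ {as} → TopNonzero as → TopNonzero (map (λ a → x * σ a) as)
  map-top x≉0 [ a≉0 ] = [ *-≉0 x≉0 (a≉0 ∘ σ≈0⇒≈0) ]
  map-top x≉0 (a ∷ top) = _ ∷ map-top x≉0 top

  resolvent-top : ∀ {x} → ¬ x ≈ 0# → ∀ k → TopNonzero (resolvent x (suc k))
  resolvent-top x≉0 zero = [ 1≉0 ]
  resolvent-top x≉0 (suc k) = _ ∷ map-top x≉0 (resolvent-top x≉0 k)

  length-resolvent : ∀ x k → length (resolvent x k) ≡ k
  length-resolvent x zero = ≡.refl
  length-resolvent x (suc k) = ≡.cong suc (≡.trans (Listₚ.length-map _ (resolvent x k)) (length-resolvent x k))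

  -- Let y be the Lagrange resolvent of t. Extending it by one term at either end gives t + x σ(y) =
  -- y + norm x · σⁿ(t) = y + t. Dedekind's lemma supplies a t with y ≠ 0.
  hilbert90 : ∀ {x} → ¬ x ≈ 0# → norm x ≈ 1# → ∃ λ y → ¬ y ≈ 0# × x * σ y ≈ y
  hilbert90 {x} x≉0 norm≈1 = witness nonzero
    where
    1+pred : ∀ {m} → 1 ≤ m → suc (ℕ.pred m) ≡ m
    1+pred (s≤s z≤n) = ≡.refl
    nonzero : ∃ λ t → ¬ apply (resolvent x n) t ≈ 0#
    nonzero = ≡.subst (λ m → ∃ λ t → ¬ apply (resolvent x m) t ≈ 0#) (1+pred 1≤n)
      (dedekind (ℕ.pred n) (resolvent-top x≉0 (ℕ.pred n)) (length-resolvent x _) (ℕₚ.≤-reflexive (1+pred 1≤n)))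
    witness : (∃ λ t → ¬ apply (resolvent x n) t ≈ 0#) → _
    witness (t , y≉0) = apply (resolvent x n) t , y≉0 , (begin
      x * σ y                          ≈⟨ solve 2 (λ t p → p := t :+ p :- t) refl t _ ⟩
      t + x * σ y - t                  ≈⟨ +-congʳ (trans (sym (resolvent-step x n t)) (resolvent-snoc x n t)) ⟩
      y + norm x * iter σ n t - t      ≈⟨ +-congʳ (+-congˡ (trans (*-cong norm≈1 (σⁿ≈id t)) (*-identityˡ t))) ⟩
      y + t - t                        ≈⟨ solve 2 (λ t p → p :+ t :- t := p) refl t y ⟩
      y                                ∎)
      where y = apply (resolvent x n) t

  -- The chosen witness depends only on the class of x, up to propositional equality. The
  -- injectivity argument for norms compares choices made at equivalent arguments.
  choice : ∀ {R : Carrier → Carrier → Set} → (∀ {x} → Resp (R x)) → (∀ {y} → Resp (λ x → R x y)) →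
           (∀ x y → Dec (R x y)) →
           Σ (Carrier → Carrier) λ g → (∀ {x y} → x ≈ y → g x ≡ g y) × (∀ {x z} → R x z → R x (g x))
  choice {R} resp resp′ R? = g ∘ canon , (λ eq → ≡.cong g (canon-cong eq)) ,
    λ {x} r → resp′ (sym (elem-index x)) (g-sound (resp′ (elem-index x) r))
    where
    g : Carrier → Carrier
    g x with search resp (R? x)
    ... | yes (z , _) = z
    ... | no _ = 0#
    g-sound : ∀ {x z} → R x z → R x (g x)
    g-sound {x} {z} r with search resp (R? x)
    ... | yes (_ , r′) = r′
    ... | no ∄ = contradiction (z , r) ∄

  -- Let ρ ν be a chosen element of norm ν and h u a chosen nonzero solution of u σ(h) = h.
  -- Then x ↦ h (x / ρ (norm x)) · norm x is injective on nonzero elements, hence surjective,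
  -- and it takes the value ν h 1 only at elements of norm ν.
  module NormSurjective {ν} (ν≉0 : ¬ ν ≈ 0#) (fν : Fixed ν) where
    ρ-choice = choice {λ ν x → norm x ≈ ν} (λ eq r → trans (N-cong n (sym eq)) r) (λ eq r → trans r eq)
                 (λ ν x → norm x ≟ ν)
    h-choice = choice {λ u y → ¬ y ≈ 0# × u * σ y ≈ y}
                 (λ eq (≉0 , e) → ≉0-resp eq ≉0 , trans (*-congˡ (cong-σ (sym eq))) (trans e eq))
                 (λ eq (≉0 , e) → ≉0 , trans (*-congʳ (sym eq)) e)
                 (λ u y → Dec.¬? (y ≟ 0#) Dec.×-dec (u * σ y ≟ y))
    ρ = proj₁ ρ-choice
    h = proj₁ h-choice

    u : Carrier → Carrier
    u x = x * ρ (norm x) ⁻¹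

    norm-ρ : ∀ x → norm (ρ (norm x)) ≈ norm x
    norm-ρ x = proj₂ (proj₂ ρ-choice) refl

    N0≈0 : ∀ {m} → 1 ≤ m → N m 0# ≈ 0#
    N0≈0 (s≤s z≤n) = zeroˡ _

    ρ≉0 : ∀ {x} → ¬ x ≈ 0# → ¬ ρ (norm x) ≈ 0#
    ρ≉0 {x} x≉0 ρ≈0 = N-≉0 n x≉0 (trans (sym (norm-ρ x)) (trans (N-cong n ρ≈0) (N0≈0 1≤n)))

    h-spec : ∀ {x} → ¬ x ≈ 0# → ¬ h (u x) ≈ 0# × u x * σ (h (u x)) ≈ h (u x)
    h-spec {x} x≉0 = proj₂ (proj₂ h-choice) (proj₂ (hilbert90
      (*-≉0 x≉0 (⁻¹-≉0 (ρ≉0 x≉0))) (norm-/ (ρ≉0 x≉0) (sym (norm-ρ x)))))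

    f : ∀ x → ¬ x ≈ 0# → Carrier
    f x _ = h (u x) * norm x

    f≉0 : ∀ x x≉0 → ¬ f x x≉0 ≈ 0#
    f≉0 x x≉0 = *-≉0 (proj₁ (h-spec x≉0)) (N-≉0 n x≉0)

    u-f : ∀ x x≉0 → u x * σ (f x x≉0) ≈ f x x≉0
    u-f x x≉0 = begin
      u x * σ (h (u x) * norm x)    ≈⟨ *-congˡ (trans (σ-* _ _) (*-congˡ (norm-fixed x≉0))) ⟩
      u x * (σ (h (u x)) * norm x)  ≈⟨ *-assoc _ _ _ ⟨
      u x * σ (h (u x)) * norm x    ≈⟨ *-congʳ (proj₂ (h-spec x≉0)) ⟩
      h (u x) * norm x              ∎

    -- Since `f x` is a σ-fixed multiple of `h (u x)`, the quotient f x / σ(f x) recovers `u x`.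
    -- Then f x / h (u x) recovers `norm x`, and x is u x · ρ (norm x).
    f-injective : ∀ {x y} x≉0 y≉0 → f x x≉0 ≈ f y y≉0 → x ≈ y
    f-injective {x} {y} x≉0 y≉0 eq = *-cancelʳ (⁻¹-≉0 (ρ≉0 x≉0))
      (trans u-eq (*-congˡ (reflexive (≡.cong _⁻¹ (≡.sym (proj₁ (proj₂ ρ-choice) norm-eq))))))
      where
      u-eq : u x ≈ u y
      u-eq = *-cancelʳ (f≉0 x x≉0 ∘ σ≈0⇒≈0) (begin
        u x * σ (f x x≉0)  ≈⟨ u-f x x≉0 ⟩
        f x x≉0            ≈⟨ eq ⟩
        f y y≉0            ≈⟨ u-f y y≉0 ⟨
        u y * σ (f y y≉0)  ≈⟨ *-congˡ (cong-σ eq) ⟨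
        u y * σ (f x x≉0)  ∎)
      norm-eq : norm x ≈ norm y
      norm-eq = *-cancelˡ (proj₁ (h-spec x≉0))
        (trans eq (*-congʳ (reflexive (proj₁ (proj₂ h-choice) (sym u-eq)))))

    h1-spec : ¬ h 1# ≈ 0# × 1# * σ (h 1#) ≈ h 1#
    h1-spec = proj₂ (proj₂ h-choice) (1≉0 , trans (*-identityˡ _) σ-1)

    preimage = injective⇒surjective (λ eq → ≉0-resp eq) (λ x → Dec.¬? (x ≟ 0#)) f f≉0 f-injective
                 (h 1# * ν) (*-≉0 (proj₁ h1-spec) ν≉0)
    x₀ = proj₁ preimage
    x₀≉0 = proj₁ (proj₂ preimage)
    hν≈f = proj₂ (proj₂ preimage)

    f-fixed : Fixed (f x₀ x₀≉0)
    f-fixed = fixed-resp hν≈f (fixed-* (trans (sym (*-identityˡ _)) (proj₂ h1-spec)) fν)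

    -- By `u-f`, the factor `u x₀` measures how far the value is from being fixed by σ; the target
    -- `h 1# * ν` is fixed because `h 1#` and ν are.
    u≈1 : u x₀ ≈ 1#
    u≈1 = *-cancelʳ (f≉0 x₀ x₀≉0)
      (trans (*-congˡ (sym f-fixed)) (trans (u-f x₀ x₀≉0) (sym (*-identityˡ _))))

    ν≈norm : ν ≈ norm x₀
    ν≈norm = *-cancelˡ (proj₁ h1-spec) (trans hν≈f (*-congʳ (reflexive (proj₁ (proj₂ h-choice) u≈1))))

  abstract
    norm-surjective : ∀ {ν} → ¬ ν ≈ 0# → Fixed ν → ∃ λ μ → ¬ μ ≈ 0# × norm μ ≈ ν
    norm-surjective ν≉0 fν = x₀ , x₀≉0 , sym ν≈norm
      where open NormSurjective ν≉0 fν

-- The linear recurrence attached to L and its solution built from H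

module Recurrence (F : Field) (q n : ℕ) (2≤q : 2 ≤ q) (1≤n : 1 ≤ n) (card : FieldDefs.HasCard F (q ℕ.^ n))
              (σ : Field.Carrier F → Field.Carrier F) (gen : FieldDefs.IsGaloisGenerator F q n σ) where
  open FieldDefs F hiding (zero)
  open FieldProperties F
  open RingSolver commutativeRing
  open Automorphism F q n σ gen
  open Galois F q n 2≤q 1≤n card σ gen
  open SetoidReasoning setoid

  Solves : (a b c d : Carrier) → (ℕ → Carrier) → Set
  Solves a b c d s = ∀ k → iter σ k a * s k + iter σ k b * s (suc k)
                         + iter σ k c * s (suc (suc k)) + iter σ k d * s (suc (suc (suc k))) ≈ 0#

  module Solutions {a b c d : Carrier} where
    solves-+ : ∀ {s t} → Solves a b c d s → Solves a b c d t → Solves a b c d (λ k → s k + t k)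
    solves-+ {s} {t} sol sol′ k = trans
      (solve 12 (λ a b c d x y z w x′ y′ z′ w′ →
        a :* (x :+ x′) :+ b :* (y :+ y′) :+ c :* (z :+ z′) :+ d :* (w :+ w′) :=
        (a :* x :+ b :* y :+ c :* z :+ d :* w) :+ (a :* x′ :+ b :* y′ :+ c :* z′ :+ d :* w′))
        refl _ _ _ _ _ _ _ _ _ _ _ _)
      (trans (+-cong (sol k) (sol′ k)) (+-identityʳ 0#))

    solves-scale : ∀ {s} m → Solves a b c d s → Solves a b c d (λ k → m * s k)
    solves-scale {s} m sol k = trans
      (solve 9 (λ m a b c d x y z w →
        a :* (m :* x) :+ b :* (m :* y) :+ c :* (m :* z) :+ d :* (m :* w) :=
        m :* (a :* x :+ b :* y :+ c :* z :+ d :* w))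
        refl _ _ _ _ _ _ _ _ _)
      (trans (*-congˡ (sol k)) (zeroʳ m))

    solves-sub : ∀ {s t} → Solves a b c d s → Solves a b c d t → Solves a b c d (λ k → s k - t k)
    solves-sub {s} {t} sol sol′ k = trans
      (solve 12 (λ a b c d x y z w x′ y′ z′ w′ →
        a :* (x :- x′) :+ b :* (y :- y′) :+ c :* (z :- z′) :+ d :* (w :- w′) :=
        (a :* x :+ b :* y :+ c :* z :+ d :* w) :- (a :* x′ :+ b :* y′ :+ c :* z′ :+ d :* w′))
        refl _ _ _ _ _ _ _ _ _ _ _ _)
      (trans (+-cong (sol k) (-‿cong (sol′ k))) (-‿inverseʳ 0#))

    iter-n : ∀ k x → iter σ (k ℕ.+ n) x ≈ iter σ k x
    iter-n zero x = σⁿ≈id x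
    iter-n (suc k) x = cong-σ (iter-n k x)

    -- The coefficients of the recurrence have period n because σⁿ = id. This is what makes A act on
    -- solutions.
    solves-shift : ∀ {s} → Solves a b c d s → Solves a b c d (λ k → s (k ℕ.+ n))
    solves-shift {s} sol k = trans
      (+-cong (+-cong (+-cong (term a) (term b)) (term c)) (term d)) (sol (k ℕ.+ n))
      where
      term : ∀ x {y} → iter σ k x * y ≈ iter σ (k ℕ.+ n) x * y
      term x = *-congʳ (sym (iter-n k x))

    module _ {s : ℕ → Carrier} (sol : Solves a b c d s) where
      -- As d ≠ 0, the recurrence runs forwards; applied to differences, this is uniqueness of a
      -- solution with given initial values.
      vanishes : ¬ d ≈ 0# → s 0 ≈ 0# → s 1 ≈ 0# → s 2 ≈ 0# → ∀ k → s k ≈ 0#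
      vanishes d≉0 s₀ s₁ s₂ k = proj₁ (go k)
        where
        go : ∀ k → s k ≈ 0# × s (suc k) ≈ 0# × s (suc (suc k)) ≈ 0#
        go zero = s₀ , s₁ , s₂
        go (suc k) with go k
        ... | e₀ , e₁ , e₂ = e₁ , e₂ , x*y≈0⇒y≈0 (iter-≉0 k d≉0) (begin
          iter σ k d * s (suc (suc (suc k)))  ≈⟨ solve 4 (λ a b c x →
            x := a :* :0 :+ b :* :0 :+ c :* :0 :+ x) refl _ _ _ _ ⟩
          _                                   ≈⟨ +-congʳ (+-cong (+-cong (*-congˡ e₀) (*-congˡ e₁)) (*-congˡ e₂)) ⟨
          _                                   ≈⟨ sol k ⟩
          0#                                  ∎)

      -- As a ≠ 0, the recurrence also runs backwards. This excludes the eigenvalue zero.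
      vanishes-back : ¬ a ≈ 0# → ∀ k → s k ≈ 0# → s (suc k) ≈ 0# → s (suc (suc k)) ≈ 0# → s 2 ≈ 0#
      vanishes-back a≉0 zero _ _ e₂ = e₂
      vanishes-back a≉0 (suc k) e₁ e₂ e₃ = vanishes-back a≉0 k
        (x*y≈0⇒y≈0 (iter-≉0 k a≉0) (begin
          iter σ k a * s k  ≈⟨ solve 4 (λ b c d x → x := x :+ b :* :0 :+ c :* :0 :+ d :* :0) refl _ _ _ _ ⟩
          _                 ≈⟨ +-cong (+-cong (+-congˡ (*-congˡ e₁)) (*-congˡ e₂)) (*-congˡ e₃) ⟨
          _                 ≈⟨ sol k ⟩
          0#                ∎)) e₁ e₂

  P_L-norms : ∀ a b c d y → a * N 0 y + b * N 1 y + c * N 2 y + d * N 3 y ≈ P_L σ a b c d y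
  P_L-norms a b c d y = begin
    a * 1# + b * (y * σ 1#) + c * (y * σ (y * σ 1#)) + d * (y * σ (y * σ (y * σ 1#)))
      ≈⟨ +-cong (+-cong (+-congˡ (*-congˡ (*-congˡ σ-1))) (*-congˡ (*-congˡ e₁)))
           (*-congˡ (*-congˡ (trans (cong-σ (*-congˡ e₁)) (σ-* _ _)))) ⟩
    a * 1# + b * (y * 1#) + c * (y * σ y) + d * (y * (σ y * σ (σ y)))
      ≈⟨ solve 7 (λ a b c d y y′ y″ → a :* :1 :+ b :* (y :* :1) :+ c :* (y :* y′) :+ d :* (y :* (y′ :* y″)) :=
           a :+ b :* y :+ c :* (y′ :* y) :+ d :* (y″ :* y′ :* y)) refl a b c d y (σ y) (σ (σ y)) ⟩
    P_L σ a b c d y ∎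
    where
    e₁ : σ (y * σ 1#) ≈ σ y
    e₁ = cong-σ (trans (*-congˡ σ-1) (*-identityʳ y))

  -- The equation at k + 1 is y times the image under σ of the equation at k; at k = 0 it is the
  -- root equation.
  root-solves : ∀ {a b c d y} → P_L σ a b c d y ≈ 0# → Solves a b c d (λ k → N k y)
  root-solves {a} {b} {c} {d} {y} root zero = trans (P_L-norms a b c d y) root
  root-solves {a} {b} {c} {d} {y} root (suc k) = begin
    _ ≈⟨ solve 9 (λ a b c d y p q r s →
           a :* (y :* p) :+ b :* (y :* q) :+ c :* (y :* r) :+ d :* (y :* s) :=
           y :* (a :* p :+ b :* q :+ c :* r :+ d :* s)) refl _ _ _ _ y _ _ _ _ ⟩
    _ ≈⟨ *-congˡ (+-cong (+-cong (+-cong (σ-* _ _) (σ-* _ _)) (σ-* _ _)) (σ-* _ _)) ⟨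
    _ ≈⟨ *-congˡ (trans (σ-+ _ _) (+-congʳ (trans (σ-+ _ _) (+-congʳ (σ-+ _ _))))) ⟨
    _ ≈⟨ *-congˡ (trans (cong-σ (root-solves root k)) σ-0) ⟩
    y * 0# ≈⟨ zeroʳ y ⟩
    0# ∎

  root-≉0 : ∀ {a b c d y} → ¬ a ≈ 0# → P_L σ a b c d y ≈ 0# → ¬ y ≈ 0#
  root-≉0 {a} {b} {c} {d} {y} a≉0 root y≈0 = a≉0 (begin
    a  ≈⟨ solve 5 (λ a b c d x → a := a :+ b :* :0 :+ c :* (x :* :0) :+ d :* :0) refl a b c d (σ y) ⟩
    _  ≈⟨ +-cong (+-cong (+-congˡ (*-congˡ y≈0)) (*-congˡ (*-congˡ y≈0)))
            (*-congˡ (trans (*-congˡ y≈0) (zeroʳ _))) ⟨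
    _  ≈⟨ root ⟩
    0# ∎)

  module Fundamental {a b c d : Carrier} (b≉0 : ¬ b ≈ 0#) (c≉0 : ¬ c ≈ 0#) (d≉0 : ¬ d ≈ 0#) where
    w z r : Carrier
    w = wL σ a b c
    z = zL σ b c d
    -- The recurrence at index 0 forces the next term after 0, 0, 1 to be -c / d, which has to match
    -- H₁ = -1.
    r = c * d ⁻¹

    -- The solution with initial values 0, 0, 1.
    e : ℕ → Carrier
    e zero = 0#
    e (suc zero) = 0#
    e (suc (suc k)) = N k r * H σ w z k

    σb≉0 : ¬ σ b ≈ 0#
    σb≉0 = b≉0 ∘ σ≈0⇒≈0

    σc≉0 : ¬ σ c ≈ 0#
    σc≉0 = c≉0 ∘ σ≈0⇒≈0

    dr≈c : d * r ≈ c
    dr≈c = trans (*-comm d r) (/-cancel d≉0)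

    -- In r z = (c / d) · σ(b) d / (σ(c) c) everything cancels but σ(b) / σ(c). With the companion
    -- identity for σ²(a), this expresses the coefficients of the recurrence through r, z and w.
    σc-rz : σ c * (r * z) ≈ σ b
    σc-rz = *-cancelʳ d≉0 (*-cancelʳ c≉0 (begin
      σ c * (r * z) * d * c          ≈⟨ solve 5 (λ s r z d c → s :* (r :* z) :* d :* c := (d :* r) :* (z :* (s :* c)))
                                          refl (σ c) r z d c ⟩
      (d * r) * (z * (σ c * c))      ≈⟨ *-cong dr≈c (/-cancel (*-≉0 σc≉0 c≉0)) ⟩
      c * (σ b * d)                  ≈⟨ *-comm _ _ ⟩
      σ b * d * c                    ∎))

    σ²b-rz-σw : σ (σ b) * (r * z) * σ w ≈ σ (σ a)
    σ²b-rz-σw = *-cancelˡ σc≉0 (begin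
      σ c * (σ (σ b) * (r * z) * σ w)   ≈⟨ solve 4 (λ c b x w → c :* (b :* x :* w) := (c :* x) :* b :* w)
                                             refl (σ c) (σ (σ b)) (r * z) (σ w) ⟩
      (σ c * (r * z)) * σ (σ b) * σ w   ≈⟨ *-congʳ (*-congʳ σc-rz) ⟩
      σ b * σ (σ b) * σ w               ≈⟨ solve 3 (λ x y w → x :* y :* w := w :* (y :* x)) refl (σ b) (σ (σ b)) (σ w) ⟩
      σ w * (σ (σ b) * σ b)             ≈⟨ trans (σ-* _ _) (*-congˡ (σ-* _ _)) ⟨
      σ (w * (σ b * b))                 ≈⟨ cong-σ (/-cancel (*-≉0 σb≉0 b≉0)) ⟩
      σ (σ a * c)                       ≈⟨ σ-* _ _ ⟩
      σ (σ a) * σ c                     ≈⟨ *-comm _ _ ⟩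
      σ c * σ (σ a)                     ∎)

    -- H₁ and H₂ are prescribed separately, hence the two initial cases. From index 2 on, the left
    -- side is a combination of the three vanishing expressions `rel-a`, `rel-b`, `rel-d`.
    e-solves : Solves a b c d e
    e-solves zero = begin
      a * 0# + b * 0# + c * (1# * 1#) + d * (r * σ 1# * - 1#)  ≈⟨ +-congˡ (*-congˡ (*-congʳ (*-congˡ σ-1))) ⟩
      a * 0# + b * 0# + c * (1# * 1#) + d * (r * 1# * - 1#)    ≈⟨ solve 5 (λ a b c d r →
        a :* :0 :+ b :* :0 :+ c :* (:1 :* :1) :+ d :* (r :* :1 :* :- :1) := c :- d :* r) refl a b c d r ⟩
      c - d * r                                                ≈⟨ x≈y⇒x-y≈0 (sym dr≈c) ⟩
      0#                                                       ∎
    e-solves (suc zero) = begin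
      σ a * 0# + σ b * (1# * 1#) + σ c * (r * σ 1# * - 1#) + σ d * (N 2 r * (1# + - z))
        ≈⟨ +-cong (+-congˡ (*-congˡ (*-congʳ (*-congˡ σ-1)))) (*-congˡ (*-congʳ (*-congˡ
             (cong-σ (trans (*-congˡ σ-1) (*-identityʳ r)))))) ⟩
      σ a * 0# + σ b * (1# * 1#) + σ c * (r * 1# * - 1#) + σ d * (r * σ r * (1# + - z))
        ≈⟨ solve 7 (λ a b c d r r′ z →
             a :* :0 :+ b :* (:1 :* :1) :+ c :* (r :* :1 :* :- :1) :+ d :* (r :* r′ :* (:1 :+ :- z)) :=
             (b :- c :* (r :* z)) :+ (d :* r′ :- c) :* (r :* (:1 :- z)))
             refl (σ a) (σ b) (σ c) (σ d) r (σ r) z ⟩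
      (σ b - σ c * (r * z)) + (σ d * σ r - σ c) * (r * (1# - z))
        ≈⟨ +-cong (x≈y⇒x-y≈0 (sym σc-rz))
             (trans (*-congʳ (x≈y⇒x-y≈0 (trans (sym (σ-* d r)) (cong-σ dr≈c)))) (zeroˡ _)) ⟩
      0# + 0#  ≈⟨ +-identityʳ 0# ⟩
      0#       ∎
    e-solves (suc (suc j)) = begin
      a₂ * (N j r * H₀) + b₂ * (N (suc j) r * H₁) + c₂ * (N (suc (suc j)) r * H₂)
        + d₂ * (N (suc (suc (suc j))) r * (- H₂ + - (Z₁ * H₁) + - (W₁ * (Z₁ * Z₀) * H₀)))
        ≈⟨ +-cong (+-cong (+-congˡ (*-congˡ (*-congʳ n₁))) (*-congˡ (*-congʳ n₂))) (*-congˡ (*-congʳ n₃)) ⟩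
      a₂ * (N j r * H₀) + b₂ * (N j r * r₀ * H₁) + c₂ * (N j r * r₀ * r₁ * H₂)
        + d₂ * (N j r * r₀ * r₁ * r₂ * (- H₂ + - (Z₁ * H₁) + - (W₁ * (Z₁ * Z₀) * H₀)))
        ≈⟨ solve 14 (λ a b c d n r₀ r₁ r₂ h₀ h₁ h₂ z₀ z₁ w →
             a :* (n :* h₀) :+ b :* (n :* r₀ :* h₁) :+ c :* (n :* r₀ :* r₁ :* h₂)
               :+ d :* (n :* r₀ :* r₁ :* r₂ :* (:- h₂ :+ :- (z₁ :* h₁) :+ :- (w :* (z₁ :* z₀) :* h₀))) :=
             (a :- b :* (r₀ :* z₀) :* w) :* (n :* h₀) :+ (b :- c :* (r₁ :* z₁)) :* (n :* r₀ :* (h₁ :+ z₀ :* w :* h₀))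
               :+ (d :* r₂ :- c) :* (n :* r₀ :* r₁ :* (:- h₂ :+ :- (z₁ :* h₁) :+ :- (w :* (z₁ :* z₀) :* h₀))))
             refl a₂ b₂ c₂ d₂ (N j r) r₀ r₁ r₂ H₀ H₁ H₂ Z₀ Z₁ W₁ ⟩
      (a₂ - b₂ * (r₀ * Z₀) * W₁) * _ + (b₂ - c₂ * (r₁ * Z₁)) * _ + (d₂ * r₂ - c₂) * _
        ≈⟨ +-cong (+-cong (kill rel-a) (kill rel-b)) (kill rel-d) ⟩
      0# + 0# + 0#  ≈⟨ trans (+-identityʳ _) (+-identityʳ 0#) ⟩
      0#            ∎
      where
      a₂ = iter σ (suc (suc j)) a
      b₂ = iter σ (suc (suc j)) b
      c₂ = iter σ (suc (suc j)) c
      d₂ = iter σ (suc (suc j)) d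
      r₀ = iter σ j r
      r₁ = iter σ (suc j) r
      r₂ = iter σ (suc (suc j)) r
      Z₀ = iter σ j z
      Z₁ = iter σ (suc j) z
      W₁ = iter σ (suc j) w
      H₀ = H σ w z j
      H₁ = H σ w z (suc j)
      H₂ = H σ w z (suc (suc j))
      n₁ : N (suc j) r ≈ N j r * r₀
      n₁ = N-snoc j r
      n₂ : N (suc (suc j)) r ≈ N j r * r₀ * r₁
      n₂ = trans (N-snoc (suc j) r) (*-congʳ n₁)
      n₃ : N (suc (suc (suc j))) r ≈ N j r * r₀ * r₁ * r₂
      n₃ = trans (N-snoc (suc (suc j)) r) (*-congʳ n₂)
      kill : ∀ {x m} → x ≈ 0# → x * m ≈ 0#
      kill eq = trans (*-congʳ eq) (zeroˡ _)
      shift : ∀ i x → iter σ i (σ x) ≈ iter σ (suc i) x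
      shift i x = reflexive (iter-σ i x)
      shift₂ : ∀ x → iter σ j (σ (σ x)) ≈ iter σ (suc (suc j)) x
      shift₂ x = trans (shift j (σ x)) (cong-σ (shift j x))
      rel-a : a₂ - b₂ * (r₀ * Z₀) * W₁ ≈ 0#
      rel-a = x≈y⇒x-y≈0 (begin
        a₂                                         ≈⟨ shift₂ a ⟨
        iter σ j (σ (σ a))                         ≈⟨ iter-cong j σ²b-rz-σw ⟨
        iter σ j (σ (σ b) * (r * z) * σ w)         ≈⟨ iter-* j _ _ ⟩
        _                                          ≈⟨ *-cong (trans (iter-* j _ _) (*-cong (shift₂ b) (iter-* j r z))) (shift j w) ⟩
        b₂ * (r₀ * Z₀) * W₁                        ∎)
      rel-b : b₂ - c₂ * (r₁ * Z₁) ≈ 0#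
      rel-b = x≈y⇒x-y≈0 (begin
        b₂                             ≈⟨ shift (suc j) b ⟨
        iter σ (suc j) (σ b)           ≈⟨ iter-cong (suc j) σc-rz ⟨
        iter σ (suc j) (σ c * (r * z)) ≈⟨ iter-* (suc j) _ _ ⟩
        _                              ≈⟨ *-cong (shift (suc j) c) (iter-* (suc j) r z) ⟩
        c₂ * (r₁ * Z₁)                 ∎)
      rel-d : d₂ * r₂ - c₂ ≈ 0#
      rel-d = x≈y⇒x-y≈0 (trans (sym (iter-* (suc (suc j)) d r)) (iter-cong (suc (suc j)) dr≈c))

    r≉0 : ¬ r ≈ 0#
    r≉0 = *-≉0 c≉0 (⁻¹-≉0 d≉0)

    e₂≈1 : e 2 ≈ 1#
    e₂≈1 = *-identityˡ 1#

-- Upper bounds for points on a line and for roots of P_L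

module Counting (F : Field) (q n : ℕ) (2≤q : 2 ≤ q) (1≤n : 1 ≤ n) (card : FieldDefs.HasCard F (q ℕ.^ n))
              (σ : Field.Carrier F → Field.Carrier F) (gen : FieldDefs.IsGaloisGenerator F q n σ) where
  open FieldDefs F hiding (zero)
  open FieldProperties F
  open RingSolver commutativeRing
  open Finite F (q ℕ.^ n) card
  open Automorphism F q n σ gen
  open Galois F q n 2≤q 1≤n card σ gen
  open SetoidReasoning setoid

  -- The quotient of any solution by a fixed nonzero one is fixed by σ, so there are at most as many
  -- solutions as elements of Fix σ.
  AtMost-linear : ∀ {p} r → ¬ p ≈ 0# → AtMost (λ δ → p * δ + r * σ δ ≈ 0#) q
  AtMost-linear {p} r p≉0 with search {P = λ δ → ¬ δ ≈ 0# × p * δ + r * σ δ ≈ 0#}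
      (λ eq (≉0 , e) → ≉0-resp eq ≉0 , trans (+-cong (*-congˡ (sym eq)) (*-congˡ (cong-σ (sym eq)))) e)
      (λ δ → Dec.¬? (δ ≟ 0#) Dec.×-dec (_ ≟ _))
  ... | no ∄ = AtMost-via {Q = Fixed} (HasExactly⇒AtMost fixed-exactly) (λ _ _ → 0#) (λ _ _ → σ-0)
        (λ e e′ _ → trans (≈0 e) (sym (≈0 e′)))
    where
    ≈0 : ∀ {δ} → p * δ + r * σ δ ≈ 0# → δ ≈ 0#
    ≈0 {δ} e = Dec.decidable-stable (δ ≟ 0#) (λ ≉0 → ∄ (δ , ≉0 , e))
  ... | yes (δ₀ , δ₀≉0 , e₀) = AtMost-via {Q = Fixed} (HasExactly⇒AtMost fixed-exactly) (λ δ _ → δ * δ₀ ⁻¹) fixed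
        (λ _ _ eq → *-cancelʳ (⁻¹-≉0 δ₀≉0) eq)
    where
    rσδ₀≉0 : ¬ r * σ δ₀ ≈ 0#
    rσδ₀≉0 eq = *-≉0 p≉0 δ₀≉0 (trans (sym (+-identityʳ _)) (trans (+-congˡ (sym eq)) e₀))
    fixed : ∀ δ → p * δ + r * σ δ ≈ 0# → Fixed (δ * δ₀ ⁻¹)
    fixed δ e = x-y≈0⇒x≈y (x*y≈0⇒y≈0 rσδ₀≉0 (begin
      r * σ δ₀ * (σ x - x)                                ≈⟨ solve 6 (λ p r d d′ x x′ →
        r :* d′ :* (x′ :- x) := p :* (x :* d) :+ r :* (x′ :* d′) :- x :* (p :* d :+ r :* d′))
        refl p r δ₀ (σ δ₀) x (σ x) ⟩
      p * (x * δ₀) + r * (σ x * σ δ₀) - x * (p * δ₀ + r * σ δ₀)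
        ≈⟨ +-cong (+-cong (*-congˡ xδ₀≈δ) (*-congˡ (trans (sym (σ-* x δ₀)) (cong-σ xδ₀≈δ)))) (-‿cong (*-congˡ e₀)) ⟩
      p * δ + r * σ δ - x * 0#                            ≈⟨ +-congʳ e ⟩
      0# - x * 0#                                         ≈⟨ solve 1 (λ x → :0 :- x :* :0 := :0) refl x ⟩
      0#                                                  ∎))
      where
      x = δ * δ₀ ⁻¹
      xδ₀≈δ : x * δ₀ ≈ δ
      xδ₀≈δ = /-cancel δ₀≉0

  AtMost-affine : ∀ {p} r k → ¬ p ≈ 0# → AtMost (λ ρ → p * ρ + r * σ ρ + k ≈ 0#) q
  AtMost-affine {p} r k p≉0 with search {P = λ ρ → p * ρ + r * σ ρ + k ≈ 0#}
      (λ eq e → trans (+-congʳ (+-cong (*-congˡ (sym eq)) (*-congˡ (cong-σ (sym eq))))) e) (λ ρ → _ ≟ _)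
  ... | no ∄ = (λ ρ e → contradiction (ρ , e) ∄) , λ e _ _ → contradiction (_ , e) ∄
  ... | yes (ρ₀ , e₀) = AtMost-via {Q = λ δ → p * δ + r * σ δ ≈ 0#} (AtMost-linear r p≉0) (λ ρ _ → ρ - ρ₀)
      (λ ρ e → begin
        p * (ρ - ρ₀) + r * σ (ρ - ρ₀)    ≈⟨ +-congˡ (*-congˡ (σ-sub ρ ρ₀)) ⟩
        p * (ρ - ρ₀) + r * (σ ρ - σ ρ₀)  ≈⟨ solve 7 (λ p r k x x′ y y′ →
          p :* (x :- y) :+ r :* (x′ :- y′) := p :* x :+ r :* x′ :+ k :- (p :* y :+ r :* y′ :+ k))
          refl p r k ρ (σ ρ) ρ₀ (σ ρ₀) ⟩
        _ - _                            ≈⟨ +-cong e (-‿cong e₀) ⟩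
        0# - 0#                          ≈⟨ -‿inverseʳ 0# ⟩
        0#                               ∎)
      (λ {ρ} {ρ′} _ _ eq → trans (solve 2 (λ x y → x := (x :- y) :+ y) refl ρ ρ₀)
        (trans (+-congʳ eq) (solve 2 (λ x y → (x :- y) :+ y := x) refl ρ′ ρ₀)))

  Quadratic : Carrier → Carrier → Carrier → Carrier → Set
  Quadratic p e h v = p * (v * σ v) + e * v + h ≈ 0#

  -- Substituting v = v₀ + 1 / ρ makes the equation affine in ρ.
  AtMost-quadratic : ∀ {p e h v₀} → ¬ p ≈ 0# → ¬ v₀ ≈ 0# → Quadratic p e h v₀ →
                     AtMost (λ v → ¬ v ≈ v₀ × Quadratic p e h v) q
  AtMost-quadratic {p} {e} {h} {v₀} p≉0 v₀≉0 sol₀ = AtMost-via {Q = λ ρ → p * v₀ * ρ + (p * σ v₀ + e) * σ ρ + p ≈ 0#}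
    (AtMost-affine (p * σ v₀ + e) p (*-≉0 p≉0 v₀≉0)) (λ v _ → (v - v₀) ⁻¹)
    (λ v (v≉v₀ , sol) → affine v (≉⇒-≉0 v≉v₀) sol)
    λ {v} {v′} (v≉ , _) (v′≉ , _) eq → +-cancelʳ′ (*-cancelʳ (⁻¹-≉0 (≉⇒-≉0 v≉)) (begin
        (v - v₀) * (v - v₀) ⁻¹    ≈⟨ ⁻¹-inverse _ (≉⇒-≉0 v≉) ⟩
        1#                        ≈⟨ ⁻¹-inverse _ (≉⇒-≉0 v′≉) ⟨
        (v′ - v₀) * (v′ - v₀) ⁻¹  ≈⟨ *-congˡ eq ⟨
        (v′ - v₀) * (v - v₀) ⁻¹   ∎))
    where
    +-cancelʳ′ : ∀ {v v′} → v - v₀ ≈ v′ - v₀ → v ≈ v′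
    +-cancelʳ′ {v} {v′} eq = trans (solve 2 (λ x y → x := (x :- y) :+ y) refl v v₀)
        (trans (+-congʳ eq) (solve 2 (λ x y → (x :- y) :+ y := x) refl v′ v₀))
    affine : ∀ v → ¬ v - v₀ ≈ 0# → Quadratic p e h v →
             let ρ = (v - v₀) ⁻¹ in p * v₀ * ρ + (p * σ v₀ + e) * σ ρ + p ≈ 0#
    affine v t≉0 sol = begin
      p * v₀ * ρ + (p * σ v₀ + e) * ρ′ + p
        ≈⟨ solve 6 (λ p e x x′ r r′ → p :* x :* r :+ (p :* x′ :+ e) :* r′ :+ p :=
             p :* x :* r :* :1 :+ (p :* x′ :+ e) :* r′ :* :1 :+ p :* (:1 :* :1)) refl p e v₀ (σ v₀) ρ ρ′ ⟩
      p * v₀ * ρ * 1# + (p * σ v₀ + e) * ρ′ * 1# + p * (1# * 1#)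
        ≈⟨ +-cong (+-cong (*-congˡ t′ρ′≈1) (*-congˡ tρ≈1)) (*-congˡ (*-cong tρ≈1 t′ρ′≈1)) ⟨
      p * v₀ * ρ * ((σ v - σ v₀) * ρ′) + (p * σ v₀ + e) * ρ′ * ((v - v₀) * ρ) + p * (((v - v₀) * ρ) * ((σ v - σ v₀) * ρ′))
        ≈⟨ solve 9 (λ p e h x x′ y y′ r r′ →
             p :* x :* r :* ((y′ :- x′) :* r′) :+ (p :* x′ :+ e) :* r′ :* ((y :- x) :* r) :+ p :* (((y :- x) :* r) :* ((y′ :- x′) :* r′)) :=
             r :* r′ :* ((p :* (y :* y′) :+ e :* y :+ h) :- (p :* (x :* x′) :+ e :* x :+ h)))
             refl p e h v₀ (σ v₀) v (σ v) ρ ρ′ ⟩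
      ρ * ρ′ * (_ - _)    ≈⟨ *-congˡ (+-cong sol (-‿cong sol₀)) ⟩
      ρ * ρ′ * (0# - 0#)  ≈⟨ solve 1 (λ x → x :* (:0 :- :0) := :0) refl (ρ * ρ′) ⟩
      0#                  ∎
      where
      ρ = (v - v₀) ⁻¹
      ρ′ = σ ρ
      tρ≈1 : (v - v₀) * ρ ≈ 1#
      tρ≈1 = ⁻¹-inverse _ t≉0
      t′ρ′≈1 : (σ v - σ v₀) * ρ′ ≈ 1#
      t′ρ′≈1 = trans (*-congʳ (sym (σ-sub v v₀))) (σ-⁻¹ t≉0)

  -- Twice the signed area of the triangle with vertices (yᵢ , yᵢ σ(yᵢ)).
  area : Carrier → Carrier → Carrier → Carrier
  area y₁ y₂ y₃ = (y₂ - y₁) * (y₃ * σ y₃ - y₁ * σ y₁) - (y₃ - y₁) * (y₂ * σ y₂ - y₁ * σ y₁)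

  -- The base point `y₁` is excluded because it serves as the known solution around which the
  -- quadratic equation is made affine.
  OnLine : Carrier → Carrier → Carrier → Set
  OnLine y₁ y₂ y = ¬ y ≈ y₁ × area y₁ y₂ y ≈ 0#

  -- Collinearity with the first two points is a `Quadratic` equation in y, with leading coefficient
  -- y₂ - y₁ and known solution y₁.
  AtMost-line : ∀ {y₁ y₂} → ¬ y₁ ≈ 0# → ¬ y₂ ≈ y₁ → AtMost (OnLine y₁ y₂) q
  AtMost-line {y₁} {y₂} y₁≉0 y₂≉y₁ = AtMost-via
    (AtMost-quadratic {p = y₂ - y₁} {e = - (y₂ * σ y₂ - y₁ * σ y₁)}
      {h = (y₂ * σ y₂ - y₁ * σ y₁) * y₁ - (y₂ - y₁) * (y₁ * σ y₁)} {v₀ = y₁} (≉⇒-≉0 y₂≉y₁) y₁≉0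
      (trans (sym (rearranged y₁)) (solve 4 (λ x x′ y y′ →
        (y :- x) :* (x :* x′ :- x :* x′) :- (x :- x) :* (y :* y′ :- x :* x′) := :0) refl y₁ (σ y₁) y₂ (σ y₂))))
    (λ y _ → y) (λ y (y≉y₁ , on) → y≉y₁ , trans (sym (rearranged y)) on) (λ _ _ eq → eq)
    where
    rearranged : ∀ y → area y₁ y₂ y ≈ (y₂ - y₁) * (y * σ y) + - (y₂ * σ y₂ - y₁ * σ y₁) * y
                                    + ((y₂ * σ y₂ - y₁ * σ y₁) * y₁ - (y₂ - y₁) * (y₁ * σ y₁))
    rearranged y = solve 6 (λ x x′ y y′ z z′ →
      (y :- x) :* (z :* z′ :- x :* x′) :- (z :- x) :* (y :* y′ :- x :* x′) :=
      (y :- x) :* (z :* z′) :+ :- (y :* y′ :- x :* x′) :* z :+ ((y :* y′ :- x :* x′) :* x :- (y :- x) :* (x :* x′)))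
      refl y₁ (σ y₁) y₂ (σ y₂) y (σ y)

  -- The slopes of the lines joining (y₁ , y₁ σ(y₁)) to the other roots satisfy a
  -- quadratic equation, and each line contains at most q further roots.
  AtMost-P_L-roots : ∀ {a b c d} → ¬ a ≈ 0# → ¬ d ≈ 0# → (∀ {y} → P_L σ a b c d y ≈ 0# → ¬ y ≈ 0#) →
                     AtMost (λ y → P_L σ a b c d y ≈ 0#) (1 ℕ.+ (1 ℕ.+ q) ℕ.* q)
  AtMost-P_L-roots {a} {b} {c} {d} a≉0 d≉0 root-≉0 with search {P = λ y → P_L σ a b c d y ≈ 0#} resp (λ y → _ ≟ _)
    where
    resp : Resp (λ y → P_L σ a b c d y ≈ 0#)
    resp eq root = trans (+-cong (+-cong (+-congˡ (*-congˡ (sym eq)))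
      (*-congˡ (*-cong (cong-σ (sym eq)) (sym eq))))
      (*-congˡ (*-cong (*-cong (iter-cong 2 (sym eq)) (cong-σ (sym eq))) (sym eq)))) root
  ... | no ∄ = (λ y root → contradiction (y , root) ∄) , λ root _ _ → contradiction (_ , root) ∄
  ... | yes (y₁ , root₁) = AtMost-∪ (AtMost-singleton y₁) others λ y root → split y root (y ≟ y₁)
    where
    Root : Carrier → Set
    Root y = P_L σ a b c d y ≈ 0#

    y₁≉0 : ¬ y₁ ≈ 0#
    y₁≉0 = root-≉0 root₁

    -- These come from P_L(y) - P_L(y₁) = (y - y₁) (d v σ(v) + e v + h), where v is the slope of y.
    -- Moreover h y₁ = P_L(y₁) - a, which is nonzero, and so no slope is zero.
    e h : Carrier
    e = d * σ (σ y₁) + c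
    h = b + c * σ y₁ + d * (σ y₁ * σ (σ y₁))

    hy₁≉0 : ¬ h * y₁ ≈ 0#
    hy₁≉0 hy₁≈0 = a≉0 (begin
      a                               ≈⟨ solve 7 (λ a b c d y y′ y″ → a :=
        (a :+ b :* y :+ c :* (y′ :* y) :+ d :* (y″ :* y′ :* y)) :- (b :+ c :* y′ :+ d :* (y′ :* y″)) :* y)
        refl a b c d y₁ (σ y₁) (σ (σ y₁)) ⟩
      P_L σ a b c d y₁ - h * y₁       ≈⟨ +-cong root₁ (-‿cong hy₁≈0) ⟩
      0# - 0#                         ≈⟨ -‿inverseʳ 0# ⟩
      0#                              ∎)

    split : ∀ y → Root y → Dec (y ≈ y₁) → y ≈ y₁ ⊎ (¬ y ≈ y₁ × Root y)
    split y root (yes eq) = inj₁ eq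
    split y root (no ≉) = inj₂ (≉ , root)

    AtMost-slopes : AtMost (Quadratic d e h) (1 ℕ.+ q)
    AtMost-slopes with search {P = Quadratic d e h}
        (λ eq sol → trans (+-congʳ (+-cong (*-congˡ (*-cong (sym eq) (cong-σ (sym eq)))) (*-congˡ (sym eq)))) sol)
        (λ v → _ ≟ _)
    ... | no ∄ = (λ v sol → contradiction (v , sol) ∄) , λ sol _ _ → contradiction (_ , sol) ∄
    ... | yes (v₀ , sol₀) = AtMost-∪ (AtMost-singleton v₀) (AtMost-quadratic d≉0 v₀≉0 sol₀) cover
      where
      v₀≉0 : ¬ v₀ ≈ 0#
      v₀≉0 v₀≈0 = *-≉0⇒≉0ˡ hy₁≉0 (begin
        h                                    ≈⟨ solve 4 (λ d e h s → h := d :* (:0 :* s) :+ e :* :0 :+ h) refl d e h (σ v₀) ⟩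
        d * (0# * σ v₀) + e * 0# + h         ≈⟨ +-congʳ (+-cong (*-congˡ (*-congʳ v₀≈0)) (*-congˡ v₀≈0)) ⟨
        d * (v₀ * σ v₀) + e * v₀ + h         ≈⟨ sol₀ ⟩
        0#                                   ∎)
      cover : ∀ v → Quadratic d e h v → v ≈ v₀ ⊎ (¬ v ≈ v₀ × Quadratic d e h v)
      cover v sol with v ≟ v₀
      ... | yes eq = inj₁ eq
      ... | no ≉ = inj₂ (≉ , sol)

    -- Subtracting σ(y₁) from the slope of the chord makes it y σ(y - y₁) / (y - y₁), whose product
    -- with σ(slope) is easy to relate to y σ(y) σ²(y).
    slope : Carrier → Carrier
    slope y = (y * σ y - y₁ * σ y₁) * (y - y₁) ⁻¹ - σ y₁

    slope-spec : ∀ {y} → ¬ y ≈ y₁ → y * σ y ≈ y₁ * σ y₁ + (y - y₁) * (slope y + σ y₁)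
    slope-spec {y} y≉y₁ = begin
      y * σ y                                                ≈⟨ solve 2 (λ s s₁ → s := s₁ :+ (s :- s₁)) refl _ (y₁ * σ y₁) ⟩
      y₁ * σ y₁ + (y * σ y - y₁ * σ y₁)                      ≈⟨ +-congˡ (/-cancel (≉⇒-≉0 y≉y₁)) ⟨
      y₁ * σ y₁ + (y * σ y - y₁ * σ y₁) * (y - y₁) ⁻¹ * (y - y₁)  ≈⟨ solve 4 (λ s₁ k t y′ →
        s₁ :+ k :* t := s₁ :+ t :* (k :- y′ :+ y′)) refl _ _ (y - y₁) (σ y₁) ⟩
      y₁ * σ y₁ + (y - y₁) * (slope y + σ y₁)                ∎

    slope-quadratic : ∀ y → ¬ y ≈ y₁ × Root y → Quadratic d e h (slope y)
    slope-quadratic y (y≉y₁ , root) = x*y≈0⇒y≈0 (≉⇒-≉0 y≉y₁) (begin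
      t * (d * (v * σ v) + e * v + h)
        ≈⟨ solve 10 (λ a b c d y x x′ x″ v v′ →
             (y :- x) :* (d :* (v :* v′) :+ (d :* x″ :+ c) :* v :+ (b :+ c :* x′ :+ d :* (x′ :* x″))) :=
             (a :+ b :* y :+ c :* (x :* x′ :+ (y :- x) :* (v :+ x′)) :+ d :* (x′ :* x″ :* y :+ (y :- x) :* v :* (v′ :+ x″)))
             :- (a :+ b :* x :+ c :* (x′ :* x) :+ d :* (x″ :* x′ :* x)))
             refl a b c d y y₁ (σ y₁) (σ (σ y₁)) v (σ v) ⟩
      (a + b * y + c * (y₁ * σ y₁ + t * (v + σ y₁)) + d * (σ y₁ * σ (σ y₁) * y + t * v * (σ v + σ (σ y₁))))
        - P_L σ a b c d y₁
        ≈⟨ +-cong (+-cong (+-congˡ (*-congˡ eq₂)) (*-congˡ eq₃)) (-‿cong root₁) ⟩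
      P_L σ a b c d y - 0#   ≈⟨ +-congʳ root ⟩
      0# - 0#                ≈⟨ -‿inverseʳ 0# ⟩
      0#                     ∎)
      where
      t = y - y₁
      v = slope y
      eq₂ : y₁ * σ y₁ + t * (v + σ y₁) ≈ σ y * y
      eq₂ = trans (sym (slope-spec y≉y₁)) (*-comm y (σ y))
      tv≈yσt : t * v ≈ y * σ t
      tv≈yσt = begin
        t * v                                                ≈⟨ solve 5 (λ y x y′ x′ v →
          (y :- x) :* v := (x :* x′ :+ (y :- x) :* (v :+ x′)) :- y :* x′) refl y y₁ (σ y) (σ y₁) v ⟩
        (y₁ * σ y₁ + t * (v + σ y₁)) - y * σ y₁              ≈⟨ +-congʳ (slope-spec y≉y₁) ⟨
        y * σ y - y * σ y₁                                   ≈⟨ solve 3 (λ y y′ x′ → y :* y′ :- y :* x′ := y :* (y′ :- x′)) refl y (σ y) (σ y₁) ⟩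
        y * (σ y - σ y₁)                                     ≈⟨ *-congˡ (σ-sub y y₁) ⟨
        y * σ t                                              ∎
      σ-spec : σ y * σ (σ y) ≈ σ y₁ * σ (σ y₁) + σ t * (σ v + σ (σ y₁))
      σ-spec = begin
        σ y * σ (σ y)                                        ≈⟨ σ-* _ _ ⟨
        σ (y * σ y)                                          ≈⟨ cong-σ (slope-spec y≉y₁) ⟩
        σ (y₁ * σ y₁ + t * (v + σ y₁))                       ≈⟨ trans (σ-+ _ _) (+-cong (σ-* _ _) (trans (σ-* _ _) (*-congˡ (σ-+ _ _)))) ⟩
        σ y₁ * σ (σ y₁) + σ t * (σ v + σ (σ y₁))             ∎
      eq₃ : σ y₁ * σ (σ y₁) * y + t * v * (σ v + σ (σ y₁)) ≈ σ (σ y) * σ y * y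
      eq₃ = begin
        σ y₁ * σ (σ y₁) * y + t * v * (σ v + σ (σ y₁))       ≈⟨ +-congˡ (*-congʳ tv≈yσt) ⟩
        σ y₁ * σ (σ y₁) * y + y * σ t * (σ v + σ (σ y₁))     ≈⟨ solve 4 (λ p y t r → p :* y :+ y :* t :* r := (p :+ t :* r) :* y) refl _ y (σ t) _ ⟩
        (σ y₁ * σ (σ y₁) + σ t * (σ v + σ (σ y₁))) * y       ≈⟨ *-congʳ (trans (*-comm _ _) σ-spec) ⟨
        σ (σ y) * σ y * y                                    ∎

    others : AtMost (λ y → ¬ y ≈ y₁ × Root y) ((1 ℕ.+ q) ℕ.* q)
    others = AtMost-fibres {Q = Quadratic d e h} AtMost-slopes (λ y _ → slope y) slope-quadratic λ s →
      AtMost-via (AtMost-quadratic {p = 1#} {e = - (s + σ y₁)} {h = (s + σ y₁) * y₁ - y₁ * σ y₁} {v₀ = y₁} 1≉0 y₁≉0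
          (solve 3 (λ s x x′ → :1 :* (x :* x′) :+ :- (s :+ x′) :* x :+ ((s :+ x′) :* x :- x :* x′) := :0) refl s y₁ (σ y₁)))
        (λ y _ → y)
        (λ y ((y≉y₁ , _) , slope≈s) → y≉y₁ , (begin
          1# * (y * σ y) + - (s + σ y₁) * y + ((s + σ y₁) * y₁ - y₁ * σ y₁)
            ≈⟨ +-congʳ (+-congʳ (*-congˡ (trans (slope-spec y≉y₁) (+-congˡ (*-congˡ (+-congʳ slope≈s)))))) ⟩
          1# * (y₁ * σ y₁ + (y - y₁) * (s + σ y₁)) + - (s + σ y₁) * y + ((s + σ y₁) * y₁ - y₁ * σ y₁)
            ≈⟨ solve 4 (λ s x x′ y → :1 :* (x :* x′ :+ (y :- x) :* (s :+ x′)) :+ :- (s :+ x′) :* y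
                 :+ ((s :+ x′) :* x :- x :* x′) := :0) refl s y₁ (σ y₁) y ⟩
          0#  ∎))
        (λ _ _ eq → eq)

-- These leave a second, a third and a fourth root outside 1, 1 + q and 3 q excluded ones; the last
-- inequality uses 2 q ≤ q².
q²+q+1-bounds : ∀ {q} → 2 ≤ q → 1 < q ℕ.^ 2 ℕ.+ q ℕ.+ 1 × 1 ℕ.+ q < q ℕ.^ 2 ℕ.+ q ℕ.+ 1
                              × q ℕ.+ (q ℕ.+ q) < q ℕ.^ 2 ℕ.+ q ℕ.+ 1
q²+q+1-bounds {q} 2≤q = ℕₚ.≤-<-trans (ℕₚ.m≤m+n 1 q) 1+q< , 1+q< , 3q<
  where
  3q< : q ℕ.+ (q ℕ.+ q) < q ℕ.^ 2 ℕ.+ q ℕ.+ 1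
  3q< = ≡.subst (q ℕ.+ (q ℕ.+ q) <_) (ℕₚ.+-comm 1 _) (s≤s
    (≡.subst (_≤ q ℕ.^ 2 ℕ.+ q) (ℕₚ.+-comm (q ℕ.+ q) q) (ℕₚ.+-monoˡ-≤ q
      (≡.subst₂ _≤_ (≡.cong (q ℕ.+_) (ℕₚ.+-identityʳ q)) (≡.cong (q ℕ.*_) (≡.sym (ℕₚ.*-identityʳ q)))
        (ℕₚ.*-monoˡ-≤ q 2≤q)))))
  1+q< : 1 ℕ.+ q < q ℕ.^ 2 ℕ.+ q ℕ.+ 1
  1+q< = ℕₚ.≤-<-trans (ℕₚ.+-mono-≤ 1≤q (ℕₚ.m≤m+n q q)) 3q<
    where
    1≤q = ℕₚ.≤-trans (s≤s z≤n) 2≤q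

-- From q² + q + 1 roots to the condition on H

module Forward (F : Field) (q n : ℕ) (2≤q : 2 ≤ q) (1≤n : 1 ≤ n) (card : FieldDefs.HasCard F (q ℕ.^ n))
              (σ : Field.Carrier F → Field.Carrier F) (gen : FieldDefs.IsGaloisGenerator F q n σ) where
  open FieldDefs F hiding (zero)
  open FieldProperties F
  open RingSolver commutativeRing
  open Finite F (q ℕ.^ n) card
  open Automorphism F q n σ gen
  open Galois F q n 2≤q 1≤n card σ gen
  open Recurrence F q n 2≤q 1≤n card σ gen
  open Counting F q n 2≤q 1≤n card σ gen
  open SetoidReasoning setoid

  area-cong : ∀ {x y z z′} → z ≈ z′ → area x y z ≈ area x y z′
  area-cong eq = +-cong (*-congˡ (+-congʳ (*-cong eq (cong-σ eq)))) (-‿cong (*-congʳ (+-congʳ eq)))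

  area-cyclic : ∀ x y z → area x y z ≈ area y z x
  area-cyclic x y z = solve 6 (λ x x′ y y′ z z′ →
    (y :- x) :* (z :* z′ :- x :* x′) :- (z :- x) :* (y :* y′ :- x :* x′) :=
    (z :- y) :* (x :* x′ :- y :* y′) :- (x :- y) :* (z :* z′ :- y :* y′)) refl x (σ x) y (σ y) z (σ z)

  area-degenerate : ∀ {x y z} → z ≈ y → area x y z ≈ 0#
  area-degenerate {x} {y} z≈y = trans (area-cong z≈y) (solve 4 (λ x x′ y y′ →
    (y :- x) :* (y :* y′ :- x :* x′) :- (y :- x) :* (y :* y′ :- x :* x′) := :0) refl x (σ x) y (σ y))

  on-line? : ∀ x y z → Dec (OnLine x y z)
  on-line? x y z = Dec.¬? (z ≟ x) Dec.×-dec (area x y z ≟ 0#)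

  -- `OnLine x y` omits its base point x, but x lies on the line through z and x, which u avoids as
  -- well.
  off-two-lines : ∀ {x y z u} → ¬ x ≈ z → ¬ OnLine x y u → ¬ OnLine z x u → ¬ area x y u ≈ 0#
  off-two-lines {x} {y} {z} {u} x≉z off-xy off-zx collinear =
    off-xy ((λ u≈x → off-zx ((λ u≈z → x≉z (trans (sym u≈x) u≈z)) , area-degenerate u≈x)) , collinear)

  -- No three of the points (yᵢ , yᵢ σ(yᵢ)) are collinear. The vertices are ordered so that the
  -- areas are the coefficients in Cramer's rule.
  record Quadrangle (P : Carrier → Set) : Set where
    field
      y₁ y₂ y₃ y₄ : Carrier
      P₁ : P y₁
      P₂ : P y₂
      P₃ : P y₃
      P₄ : P y₄
      area₁₂₃ : ¬ area y₁ y₂ y₃ ≈ 0#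
      area₁₂₄ : ¬ area y₁ y₂ y₄ ≈ 0#
      area₂₃₄ : ¬ area y₂ y₃ y₄ ≈ 0#
      area₃₁₄ : ¬ area y₃ y₁ y₄ ≈ 0#

  -- The sides of a triangle contain at most 3 q < q² + q + 1 of the points.
  quadrangle : ∀ {P} → (∀ {y} → P y → ¬ y ≈ 0#) → HasExactly P (q ℕ.^ 2 ℕ.+ q ℕ.+ 1) → Quadrangle P
  quadrangle {P} P≉0 exact =
    let 1< , 1+q< , 3q< = q²+q+1-bounds 2≤q
        y₁ , P₁ , _ = AtMost⇒outside {P} {λ _ → ⊥} (λ _ → no id)
          ((λ { _ (_ , ()) }) , λ { (_ , ()) }) (ℕₚ.<-trans (s≤s z≤n) 1<) exact
        y₂ , P₂ , y₂≉y₁ = AtMost⇒outside {P} {_≈ y₁} (_≟ y₁)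
          (AtMost-via {Q = _≈ y₁} (AtMost-singleton y₁) (λ y _ → y) (λ _ → proj₂) (λ _ _ eq → eq)) 1< exact
        y₃ , P₃ , y₃-off = AtMost⇒outside {P} {λ y → y ≈ y₁ ⊎ OnLine y₁ y₂ y}
          (λ y → (y ≟ y₁) Dec.⊎-dec on-line? y₁ y₂ y)
          (AtMost-∪ (AtMost-singleton y₁) (AtMost-line (P≉0 P₁) y₂≉y₁) (λ _ → proj₂)) 1+q< exact
    in fourth 3q< P₁ P₂ P₃ y₂≉y₁ (y₃-off ∘ inj₁) (y₃-off ∘ inj₂)
    where
    fourth : q ℕ.+ (q ℕ.+ q) < q ℕ.^ 2 ℕ.+ q ℕ.+ 1 → ∀ {y₁ y₂ y₃} → P y₁ → P y₂ → P y₃ →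
             ¬ y₂ ≈ y₁ → ¬ y₃ ≈ y₁ → ¬ OnLine y₁ y₂ y₃ → Quadrangle P
    fourth 3q< {y₁} {y₂} {y₃} P₁ P₂ P₃ y₂≉y₁ y₃≉y₁ off =
      let y₄ , P₄ , y₄-off = AtMost⇒outside {P} {λ y → OnLine y₁ y₂ y ⊎ (OnLine y₂ y₃ y ⊎ OnLine y₃ y₁ y)}
            (λ y → on-line? y₁ y₂ y Dec.⊎-dec (on-line? y₂ y₃ y Dec.⊎-dec on-line? y₃ y₁ y))
            (AtMost-∪ (AtMost-line (P≉0 P₁) y₂≉y₁)
              (AtMost-∪ {R = λ y → OnLine y₂ y₃ y ⊎ OnLine y₃ y₁ y}
                (AtMost-line (P≉0 P₂) y₃≉y₂) (AtMost-line (P≉0 P₃) (y₃≉y₁ ∘ sym)) (λ _ → id))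
              (λ _ → proj₂))
            3q< exact
          off₁₂ = y₄-off ∘ inj₁
          off₂₃ = y₄-off ∘ inj₂ ∘ inj₁
          off₃₁ = y₄-off ∘ inj₂ ∘ inj₂
      in record
      { y₁ = y₁ ; y₂ = y₂ ; y₃ = y₃ ; y₄ = y₄ ; P₁ = P₁ ; P₂ = P₂ ; P₃ = P₃ ; P₄ = P₄
      ; area₁₂₃ = D≉0
      ; area₁₂₄ = off-two-lines (y₃≉y₁ ∘ sym) off₁₂ off₃₁
      ; area₂₃₄ = off-two-lines y₂≉y₁ off₂₃ off₁₂
      ; area₃₁₄ = off-two-lines y₃≉y₂ off₃₁ off₂₃
      }
      where
      D≉0 : ¬ area y₁ y₂ y₃ ≈ 0#
      D≉0 D≈0 = off (y₃≉y₁ , D≈0)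
      y₃≉y₂ : ¬ y₃ ≈ y₂
      y₃≉y₂ = D≉0 ∘ area-degenerate

  norm-snoc₂ : ∀ y → N (suc (suc n)) y ≈ norm y * (y * σ y)
  norm-snoc₂ y = trans (N-snoc (suc n) y) (trans (*-cong (norm-snoc y) (cong-σ (σⁿ≈id y))) (*-assoc _ _ _))

  N₁ : ∀ y → N 1 y ≈ y
  N₁ y = trans (*-congˡ σ-1) (*-identityʳ y)

  N₂ : ∀ y → N 2 y ≈ y * σ y
  N₂ y = *-congˡ (cong-σ (N₁ y))

  combination : Carrier → Carrier → Carrier → Carrier → Carrier → Carrier → Carrier
  combination α₁ α₂ α₃ x₁ x₂ x₃ = α₁ * x₁ + α₂ * x₂ + α₃ * x₃

  combination-cong : ∀ {α₁ α₂ α₃ x₁ x₂ x₃ x₁′ x₂′ x₃′} → x₁ ≈ x₁′ → x₂ ≈ x₂′ → x₃ ≈ x₃′ →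
                     combination α₁ α₂ α₃ x₁ x₂ x₃ ≈ combination α₁ α₂ α₃ x₁′ x₂′ x₃′
  combination-cong e₁ e₂ e₃ = +-cong (+-cong (*-congˡ e₁) (*-congˡ e₂)) (*-congˡ e₃)

  module _ {a b c d y₁ y₂ y₃} (d≉0 : ¬ d ≈ 0#) (root₁ : P_L σ a b c d y₁ ≈ 0#)
           (root₂ : P_L σ a b c d y₂ ≈ 0#) (root₃ : P_L σ a b c d y₃ ≈ 0#) where
    open Solutions {a} {b} {c} {d}

    -- Both sides are solutions with the same three initial values. The factor `m` stands for the
    -- determinant and saves dividing by it.
    decompose : ∀ m α₁ α₂ α₃ {s} → Solves a b c d s →
                m * s 0 ≈ combination α₁ α₂ α₃ 1# 1# 1# →
                m * s 1 ≈ combination α₁ α₂ α₃ y₁ y₂ y₃ →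
                m * s 2 ≈ combination α₁ α₂ α₃ (y₁ * σ y₁) (y₂ * σ y₂) (y₃ * σ y₃) →
                ∀ k → m * s k ≈ combination α₁ α₂ α₃ (N k y₁) (N k y₂) (N k y₃)
    decompose m α₁ α₂ α₃ {s} sol e₀ e₁ e₂ k = x-y≈0⇒x≈y (vanishes
      (solves-sub (solves-scale m sol) (solves-+ (solves-+ (solves-scale α₁ (root-solves root₁))
        (solves-scale α₂ (root-solves root₂))) (solves-scale α₃ (root-solves root₃))))
      d≉0
      (x≈y⇒x-y≈0 e₀)
      (x≈y⇒x-y≈0 (trans e₁ (sym (combination-cong (N₁ y₁) (N₁ y₂) (N₁ y₃)))))
      (x≈y⇒x-y≈0 (trans e₂ (sym (combination-cong (N₂ y₁) (N₂ y₂) (N₂ y₃))))) k)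

  -- The area is the determinant with columns u(y₁), u(y₂), u(y₃); the equations are combined with
  -- the cofactors of its first column. The other coefficients follow by permuting the points
  -- cyclically.
  independent : ∀ {y₁ y₂ y₃ β₁ β₂ β₃} → ¬ area y₁ y₂ y₃ ≈ 0# →
                combination β₁ β₂ β₃ 1# 1# 1# ≈ 0# → combination β₁ β₂ β₃ y₁ y₂ y₃ ≈ 0# →
                combination β₁ β₂ β₃ (y₁ * σ y₁) (y₂ * σ y₂) (y₃ * σ y₃) ≈ 0# → β₁ ≈ 0#
  independent {y₁} {y₂} {y₃} {β₁} {β₂} {β₃} D≉0 e₀ e₁ e₂ = x*y≈0⇒x≈0 D≉0 (begin
    β₁ * area y₁ y₂ y₃
      ≈⟨ solve 9 (λ b₁ b₂ b₃ y₁ y₂ y₃ s₁ s₂ s₃ →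
           b₁ :* ((y₂ :- y₁) :* (s₃ :- s₁) :- (y₃ :- y₁) :* (s₂ :- s₁)) :=
           (y₂ :* s₃ :- y₃ :* s₂) :* (b₁ :* :1 :+ b₂ :* :1 :+ b₃ :* :1)
           :+ (s₂ :- s₃) :* (b₁ :* y₁ :+ b₂ :* y₂ :+ b₃ :* y₃)
           :+ (y₃ :- y₂) :* (b₁ :* s₁ :+ b₂ :* s₂ :+ b₃ :* s₃))
           refl β₁ β₂ β₃ y₁ y₂ y₃ (y₁ * σ y₁) (y₂ * σ y₂) (y₃ * σ y₃) ⟩
    _ ≈⟨ +-cong (+-cong (*-congˡ e₀) (*-congˡ e₁)) (*-congˡ e₂) ⟩
    _ ≈⟨ solve 3 (λ x y z → x :* :0 :+ y :* :0 :+ z :* :0 := :0) refl _ _ _ ⟩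
    0# ∎)

  -- Cramer's rule expresses u(y₄) through u(y₁), u(y₂), u(y₃), where u(y) = (1 , y , y σ(y)).  All u(yᵢ) are
  -- eigenvectors, with eigenvalues norm yᵢ, of the linear map (s₀ , s₁ , s₂) ↦ (sₙ , sₙ₊₁ , sₙ₊₂) on solutions.
  norm-equal : ∀ {a b c d y₁ y₂ y₃ y₄} → ¬ d ≈ 0# → P_L σ a b c d y₁ ≈ 0# → P_L σ a b c d y₂ ≈ 0# →
    P_L σ a b c d y₃ ≈ 0# → P_L σ a b c d y₄ ≈ 0# → ¬ area y₁ y₂ y₃ ≈ 0# → ¬ area y₂ y₃ y₄ ≈ 0# →
    norm y₁ ≈ norm y₄
  norm-equal {a} {b} {c} {d} {y₁} {y₂} {y₃} {y₄} d≉0 root₁ root₂ root₃ root₄ D≉0 α₁≉0 =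
    -- Mapping Cramer's relation for u(y₄) by A and subtracting norm y₄ times that relation leaves
    -- coefficients αᵢ (norm yᵢ - norm y₄) on three independent vectors, so each is zero.
    x-y≈0⇒x≈y (x*y≈0⇒y≈0 α₁≉0
      (independent D≉0
        (difference 1# 1# 1# 1# one (trans (step 0) (combination-cong (unit y₁) (unit y₂) (unit y₃))) (unit y₄))
        (difference y₁ y₂ y₃ y₄ id-case (trans (step 1) (combination-cong (norm-snoc y₁) (norm-snoc y₂) (norm-snoc y₃))) (norm-snoc y₄))
        (difference (y₁ * σ y₁) (y₂ * σ y₂) (y₃ * σ y₃) (y₄ * σ y₄) square
          (trans (step 2) (combination-cong (norm-snoc₂ y₁) (norm-snoc₂ y₂) (norm-snoc₂ y₃))) (norm-snoc₂ y₄))))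
    where
    D = area y₁ y₂ y₃
    α₁ = area y₂ y₃ y₄
    α₂ = area y₃ y₁ y₄
    α₃ = area y₁ y₂ y₄
    unit : ∀ y → norm y ≈ norm y * 1#
    unit y = sym (*-identityʳ _)
    one : D * 1# ≈ combination α₁ α₂ α₃ 1# 1# 1#
    one = solve 8 (λ y₁ y₂ y₃ y₄ s₁ s₂ s₃ s₄ →
      ((y₂ :- y₁) :* (s₃ :- s₁) :- (y₃ :- y₁) :* (s₂ :- s₁)) :* :1 :=
      ((y₃ :- y₂) :* (s₄ :- s₂) :- (y₄ :- y₂) :* (s₃ :- s₂)) :* :1
      :+ ((y₁ :- y₃) :* (s₄ :- s₃) :- (y₄ :- y₃) :* (s₁ :- s₃)) :* :1
      :+ ((y₂ :- y₁) :* (s₄ :- s₁) :- (y₄ :- y₁) :* (s₂ :- s₁)) :* :1)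
      refl y₁ y₂ y₃ y₄ (y₁ * σ y₁) (y₂ * σ y₂) (y₃ * σ y₃) (y₄ * σ y₄)
    id-case : D * y₄ ≈ combination α₁ α₂ α₃ y₁ y₂ y₃
    id-case = solve 8 (λ y₁ y₂ y₃ y₄ s₁ s₂ s₃ s₄ →
      ((y₂ :- y₁) :* (s₃ :- s₁) :- (y₃ :- y₁) :* (s₂ :- s₁)) :* y₄ :=
      ((y₃ :- y₂) :* (s₄ :- s₂) :- (y₄ :- y₂) :* (s₃ :- s₂)) :* y₁
      :+ ((y₁ :- y₃) :* (s₄ :- s₃) :- (y₄ :- y₃) :* (s₁ :- s₃)) :* y₂
      :+ ((y₂ :- y₁) :* (s₄ :- s₁) :- (y₄ :- y₁) :* (s₂ :- s₁)) :* y₃)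
      refl y₁ y₂ y₃ y₄ (y₁ * σ y₁) (y₂ * σ y₂) (y₃ * σ y₃) (y₄ * σ y₄)
    square : D * (y₄ * σ y₄) ≈ combination α₁ α₂ α₃ (y₁ * σ y₁) (y₂ * σ y₂) (y₃ * σ y₃)
    square = solve 8 (λ y₁ y₂ y₃ y₄ s₁ s₂ s₃ s₄ →
      ((y₂ :- y₁) :* (s₃ :- s₁) :- (y₃ :- y₁) :* (s₂ :- s₁)) :* s₄ :=
      ((y₃ :- y₂) :* (s₄ :- s₂) :- (y₄ :- y₂) :* (s₃ :- s₂)) :* s₁
      :+ ((y₁ :- y₃) :* (s₄ :- s₃) :- (y₄ :- y₃) :* (s₁ :- s₃)) :* s₂
      :+ ((y₂ :- y₁) :* (s₄ :- s₁) :- (y₄ :- y₁) :* (s₂ :- s₁)) :* s₃)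
      refl y₁ y₂ y₃ y₄ (y₁ * σ y₁) (y₂ * σ y₂) (y₃ * σ y₃) (y₄ * σ y₄)
    step : ∀ k → D * N (k ℕ.+ n) y₄ ≈
                 combination α₁ α₂ α₃ (N (k ℕ.+ n) y₁) (N (k ℕ.+ n) y₂) (N (k ℕ.+ n) y₃)
    step k = decompose d≉0 root₁ root₂ root₃ D α₁ α₂ α₃ (root-solves root₄) one
      (trans (*-congˡ (N₁ y₄)) id-case) (trans (*-congˡ (N₂ y₄)) square) (k ℕ.+ n)
    difference : ∀ x₁ x₂ x₃ x₄ {s} → D * x₄ ≈ combination α₁ α₂ α₃ x₁ x₂ x₃ →
      D * s ≈ combination α₁ α₂ α₃ (norm y₁ * x₁) (norm y₂ * x₂) (norm y₃ * x₃) → s ≈ norm y₄ * x₄ →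
      combination (α₁ * (norm y₁ - norm y₄)) (α₂ * (norm y₂ - norm y₄)) (α₃ * (norm y₃ - norm y₄)) x₁ x₂ x₃ ≈ 0#
    difference x₁ x₂ x₃ x₄ {s} e e′ s≈ = begin
      _ ≈⟨ solve 10 (λ a₁ a₂ a₃ x₁ x₂ x₃ n₁ n₂ n₃ n₄ →
             a₁ :* (n₁ :- n₄) :* x₁ :+ a₂ :* (n₂ :- n₄) :* x₂ :+ a₃ :* (n₃ :- n₄) :* x₃ :=
             (a₁ :* (n₁ :* x₁) :+ a₂ :* (n₂ :* x₂) :+ a₃ :* (n₃ :* x₃)) :- n₄ :* (a₁ :* x₁ :+ a₂ :* x₂ :+ a₃ :* x₃))
             refl α₁ α₂ α₃ x₁ x₂ x₃ (norm y₁) (norm y₂) (norm y₃) (norm y₄) ⟩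
      _ ≈⟨ +-cong e′ (-‿cong (*-congˡ e)) ⟨
      D * s - norm y₄ * (D * x₄)                ≈⟨ +-congʳ (*-congˡ s≈) ⟩
      D * (norm y₄ * x₄) - norm y₄ * (D * x₄)   ≈⟨ solve 3 (λ d n x → d :* (n :* x) :- n :* (d :* x) := :0) refl D (norm y₄) x₄ ⟩
      0# ∎

  quadrangle⇒scalar : ∀ {a b c d s} → ¬ a ≈ 0# → ¬ d ≈ 0# → Quadrangle (λ y → P_L σ a b c d y ≈ 0#) →
    Solves a b c d s → s 0 ≈ 0# → s 1 ≈ 0# → s 2 ≈ 1# →
    s n ≈ 0# × s (suc n) ≈ 0# × Fixed (s (suc (suc n)))
  quadrangle⇒scalar {a} {b} {c} {d} {s} a≉0 d≉0 quad sol s₀ s₁ s₂ =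
    x*y≈0⇒y≈0 area₁₂₃ (trans (step 0) (trans (combination-cong (unit ν₁) (unit ν₂) (unit ν₃))
      (trans (scaled 1# 1# 1#) (trans (*-congˡ zeroth) (zeroʳ ν))))) ,
    x*y≈0⇒y≈0 area₁₂₃ (trans (step 1) (trans (combination-cong (at₁ ν₁) (at₁ ν₂) (at₁ ν₃))
      (trans (scaled y₁ y₂ y₃) (trans (*-congˡ first) (zeroʳ ν))))) ,
    fixed-resp (sym (*-cancelˡ area₁₂₃ (trans (step 2) (trans (combination-cong (at₂ ν₁) (at₂ ν₂) (at₂ ν₃))
        (trans (scaled _ _ _) (trans (*-congˡ second) (*-comm ν D)))))))
      (norm-fixed (root-≉0 a≉0 P₄))
    where
    open Quadrangle quad
    ν = norm y₄
    D = area y₁ y₂ y₃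
    ν₁ : norm y₁ ≈ ν
    ν₁ = norm-equal d≉0 P₁ P₂ P₃ P₄ area₁₂₃ area₂₃₄
    ν₂ : norm y₂ ≈ ν
    ν₂ = norm-equal d≉0 P₂ P₃ P₁ P₄ (≉0-resp (area-cyclic _ _ _) area₁₂₃) area₃₁₄
    ν₃ : norm y₃ ≈ ν
    ν₃ = norm-equal d≉0 P₃ P₁ P₂ P₄ (≉0-resp (sym (area-cyclic _ _ _)) area₁₂₃) area₁₂₄
    -- The cofactors of the last row of the determinant: they write D · (0 , 0 , 1) as a combination
    -- of the three u(yᵢ), all with eigenvalue ν.
    γ₁ = y₃ - y₂
    γ₂ = y₁ - y₃
    γ₃ = y₂ - y₁
    zeroth : combination γ₁ γ₂ γ₃ 1# 1# 1# ≈ 0#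
    zeroth = solve 3 (λ x y z → (z :- y) :* :1 :+ (x :- z) :* :1 :+ (y :- x) :* :1 := :0) refl y₁ y₂ y₃
    first : combination γ₁ γ₂ γ₃ y₁ y₂ y₃ ≈ 0#
    first = solve 3 (λ x y z → (z :- y) :* x :+ (x :- z) :* y :+ (y :- x) :* z := :0) refl y₁ y₂ y₃
    second : combination γ₁ γ₂ γ₃ (y₁ * σ y₁) (y₂ * σ y₂) (y₃ * σ y₃) ≈ D
    second = solve 6 (λ x y z x′ y′ z′ → (z :- y) :* x′ :+ (x :- z) :* y′ :+ (y :- x) :* z′ :=
      (y :- x) :* (z′ :- x′) :- (z :- x) :* (y′ :- x′)) refl y₁ y₂ y₃ (y₁ * σ y₁) (y₂ * σ y₂) (y₃ * σ y₃)
    step : ∀ k → D * s (k ℕ.+ n) ≈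
                 combination γ₁ γ₂ γ₃ (N (k ℕ.+ n) y₁) (N (k ℕ.+ n) y₂) (N (k ℕ.+ n) y₃)
    step k = decompose d≉0 P₁ P₂ P₃ D γ₁ γ₂ γ₃ sol
      (trans (*-congˡ s₀) (trans (zeroʳ D) (sym zeroth)))
      (trans (*-congˡ s₁) (trans (zeroʳ D) (sym first)))
      (trans (*-congˡ s₂) (trans (*-identityʳ D) (sym second))) (k ℕ.+ n)
    unit : ∀ {y} → norm y ≈ ν → norm y ≈ ν * 1#
    unit eq = trans eq (sym (*-identityʳ ν))
    at₁ : ∀ {y} → norm y ≈ ν → N (suc n) y ≈ ν * y
    at₁ eq = trans (norm-snoc _) (*-congʳ eq)
    at₂ : ∀ {y} → norm y ≈ ν → N (suc (suc n)) y ≈ ν * (y * σ y)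
    at₂ eq = trans (norm-snoc₂ _) (*-congʳ eq)
    scaled : ∀ x₁ x₂ x₃ → combination γ₁ γ₂ γ₃ (ν * x₁) (ν * x₂) (ν * x₃) ≈ ν * combination γ₁ γ₂ γ₃ x₁ x₂ x₃
    scaled x₁ x₂ x₃ = solve 7 (λ a b c n x y z →
      a :* (n :* x) :+ b :* (n :* y) :+ c :* (n :* z) := n :* (a :* x :+ b :* y :+ c :* z))
      refl γ₁ γ₂ γ₃ ν x₁ x₂ x₃

1+[1+q]q≡q²+q+1 : ∀ q → 1 ℕ.+ (1 ℕ.+ q) ℕ.* q ≡ q ℕ.^ 2 ℕ.+ q ℕ.+ 1
1+[1+q]q≡q²+q+1 = solve 1 (λ q → con 1 :+ (con 1 :+ q) :* q := q :^ 2 :+ q :+ con 1) ≡.refl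
  where open +-*-Solver

-- From the condition on H to q² + q + 1 roots

module Backward (F : Field) (q n : ℕ) (2≤q : 2 ≤ q) (1≤n : 1 ≤ n) (card : FieldDefs.HasCard F (q ℕ.^ n))
              (σ : Field.Carrier F → Field.Carrier F) (gen : FieldDefs.IsGaloisGenerator F q n σ) where
  open FieldDefs F hiding (zero)
  open FieldProperties F
  open Coefficients F
  open RingSolver commutativeRing
  open Finite F (q ℕ.^ n) card
  open Automorphism F q n σ gen
  open Galois F q n 2≤q 1≤n card σ gen
  open Recurrence F q n 2≤q 1≤n card σ gen
  open Counting F q n 2≤q 1≤n card σ gen
  open SetoidReasoning setoid

  N-+ : ∀ k j y → N (k ℕ.+ j) y ≈ N k y * iter σ k (N j y)
  N-+ zero j y = sym (*-identityˡ _)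
  N-+ (suc k) j y = trans (*-congˡ (trans (cong-σ (N-+ k j y)) (σ-* _ _))) (sym (*-assoc _ _ _))

  N-+′ : ∀ j k y → N (j ℕ.+ k) y ≈ N k y * iter σ k (N j y)
  N-+′ j k y = trans (reflexive (≡.cong (λ i → N i y) (ℕₚ.+-comm j k))) (N-+ k j y)

  -- A sequence f of period n solving the recurrence yields the zeros ∑_{i<n} σⁿ⁻ⁱ(t fᵢ) of the operator.
  module Trace (t : Carrier) (f : ℕ → Carrier) where
    -- The sum of σᵐ⁻ⁱ(t f(j + i)) over i < m. The offset `j` is there because, for m = n and
    -- periodic f, it amounts to applying σʲ.
    trace : ℕ → ℕ → Carrier
    trace zero j = 0#
    trace (suc m) j = σ (trace m j + t * f (j ℕ.+ m))

    trace-suc : ∀ m j → trace (suc m) j ≈ iter σ (suc m) (t * f j) + trace m (suc j)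
    trace-suc zero j = trans (cong-σ (trans (+-identityˡ _) (*-congˡ (reflexive (≡.cong f (ℕₚ.+-identityʳ j))))))
      (sym (+-identityʳ _))
    trace-suc (suc m) j = begin
      σ (trace (suc m) j + t * f (j ℕ.+ suc m))
        ≈⟨ cong-σ (+-cong (trace-suc m j) (*-congˡ (reflexive (≡.cong f (ℕₚ.+-suc j m))))) ⟩
      σ (iter σ (suc m) (t * f j) + trace m (suc j) + t * f (suc j ℕ.+ m))
        ≈⟨ cong-σ (+-assoc _ _ _) ⟩
      σ (iter σ (suc m) (t * f j) + (trace m (suc j) + t * f (suc j ℕ.+ m)))
        ≈⟨ σ-+ _ _ ⟩
      iter σ (suc (suc m)) (t * f j) + trace (suc m) (suc j)  ∎

    -- Passing to m + 1 adds t times the recurrence at m and applies σ. At m = n the coefficients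
    -- are again a, b, c, d.
    trace-solves : ∀ {a b c d} → Solves a b c d f → ∀ m →
      iter σ m a * trace m 0 + iter σ m b * trace m 1 + iter σ m c * trace m 2 + iter σ m d * trace m 3 ≈ 0#
    trace-solves sol zero = solve 4 (λ a b c d → a :* :0 :+ b :* :0 :+ c :* :0 :+ d :* :0 := :0) refl _ _ _ _
    trace-solves sol (suc m) = begin
      _ ≈⟨ trans (σ-+ _ _) (+-cong (trans (σ-+ _ _) (+-cong (trans (σ-+ _ _) (+-cong (σ-* _ _) (σ-* _ _)))
             (σ-* _ _))) (σ-* _ _)) ⟨
      _ ≈⟨ cong-σ (solve 13 (λ a b c d t x y z w x′ y′ z′ w′ →
             a :* (x :+ t :* x′) :+ b :* (y :+ t :* y′) :+ c :* (z :+ t :* z′) :+ d :* (w :+ t :* w′) :=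
             (a :* x :+ b :* y :+ c :* z :+ d :* w) :+ t :* (a :* x′ :+ b :* y′ :+ c :* z′ :+ d :* w′))
             refl _ _ _ _ t _ _ _ _ _ _ _ _) ⟩
      _ ≈⟨ cong-σ (+-cong (trace-solves sol m) (*-congˡ (sol m))) ⟩
      σ (0# + t * 0#)  ≈⟨ cong-σ (trans (+-identityˡ _) (zeroʳ t)) ⟩
      σ 0#             ≈⟨ σ-0 ⟩
      0#               ∎

    module _ (periodic : ∀ j → f (j ℕ.+ n) ≈ f j) where
      -- Applying σ turns the first summand into σⁿ⁺¹(t f(j)) = σ(t f(j)), which periodicity makes
      -- the last summand of the window starting at j + 1.
      σ-trace : ∀ j → σ (trace n j) ≈ trace n (suc j)
      σ-trace j = begin
        σ (trace n j)                                      ≈⟨ solve 2 (λ x y → x := x :+ y :- y) refl _ (σ (t * f j)) ⟩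
        σ (trace n j) + σ (t * f j) - σ (t * f j)          ≈⟨ +-congʳ (trans (cong-σ (+-congˡ (*-congˡ (periodic j)))) (σ-+ _ _)) ⟨
        trace (suc n) j - σ (t * f j)                      ≈⟨ +-congʳ (trans (trace-suc n j) (+-congʳ (cong-σ (σⁿ≈id _)))) ⟩
        σ (t * f j) + trace n (suc j) - σ (t * f j)        ≈⟨ solve 2 (λ x y → y :+ x :- y := x) refl _ (σ (t * f j)) ⟩
        trace n (suc j)                                    ∎

      trace-zero : ∀ {a b c d} → Solves a b c d f → let x = trace n 0 in
        a * x + b * iter σ 1 x + c * iter σ 2 x + d * iter σ 3 x ≈ 0#
      trace-zero {a} {b} {c} {d} sol = begin
        _ ≈⟨ +-cong (+-cong (+-cong (*-cong (sym (σⁿ≈id a)) refl) (*-cong (sym (σⁿ≈id b)) e₁))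
               (*-cong (sym (σⁿ≈id c)) e₂)) (*-cong (sym (σⁿ≈id d)) e₃) ⟩
        _ ≈⟨ trace-solves sol n ⟩
        0# ∎
        where
        e₁ = σ-trace 0
        e₂ = trans (cong-σ e₁) (σ-trace 1)
        e₃ = trans (cong-σ e₂) (σ-trace 2)

  -- The trace of length k + 2 as an operator in σ(t), with the summands of f 0 and f 1 dropped
  -- because they vanish in the application. Its top coefficient comes from f 2. The factor `1#`
  -- only gives it the shape of `apply-map`.
  traceCoefficients : (ℕ → Carrier) → ℕ → List Carrier
  traceCoefficients f zero = []
  traceCoefficients f (suc k) = σ (f (suc (suc k))) ∷ map (λ a → 1# * σ a) (traceCoefficients f k)

  length-traceCoefficients : ∀ f k → length (traceCoefficients f k) ≡ k
  length-traceCoefficients f zero = ≡.refl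
  length-traceCoefficients f (suc k) = ≡.cong suc (≡.trans (Listₚ.length-map _ (traceCoefficients f k)) (length-traceCoefficients f k))

  traceCoefficients-top : ∀ {f} → ¬ f 2 ≈ 0# → ∀ k → TopNonzero (traceCoefficients f (suc k))
  traceCoefficients-top f₂≉0 zero = [ f₂≉0 ∘ σ≈0⇒≈0 ]
  traceCoefficients-top f₂≉0 (suc k) = _ ∷ map-top 1≉0 (traceCoefficients-top f₂≉0 k)

  apply-traceCoefficients : ∀ {f} → f 0 ≈ 0# → f 1 ≈ 0# → ∀ t k →
    Trace.trace t f (suc (suc k)) 0 ≈ apply (traceCoefficients f k) (σ t)
  apply-traceCoefficients {f} f₀ f₁ t zero = begin
    σ (σ (0# + t * f 0) + t * f 1)  ≈⟨ cong-σ (+-cong (cong-σ (+-congˡ (*-congˡ f₀))) (*-congˡ f₁)) ⟩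
    σ (σ (0# + t * 0#) + t * 0#)    ≈⟨ cong-σ (+-congʳ (cong-σ (trans (+-identityˡ _) (zeroʳ t)))) ⟩
    σ (σ 0# + t * 0#)               ≈⟨ cong-σ (+-cong σ-0 (zeroʳ t)) ⟩
    σ (0# + 0#)                     ≈⟨ trans (cong-σ (+-identityʳ 0#)) σ-0 ⟩
    0#                              ∎
  apply-traceCoefficients {f} f₀ f₁ t (suc k) = begin
    σ (Trace.trace t f (suc (suc k)) 0 + t * f (suc (suc k)))  ≈⟨ σ-+ _ _ ⟩
    _                                                          ≈⟨ +-cong (cong-σ (apply-traceCoefficients f₀ f₁ t k)) (σ-* t _) ⟩
    σ (apply as (σ t)) + σ t * σ (f (suc (suc k)))             ≈⟨ trans (+-comm _ _) (+-cong (*-comm _ _) (sym (*-identityˡ _))) ⟩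
    σ (f (suc (suc k))) * σ t + 1# * σ (apply as (σ t))        ≈⟨ +-congˡ (apply-map 1# as (σ t)) ⟨
    _                                                          ∎
    where as = traceCoefficients f k

  module _ {μ : Carrier} (μ≉0 : ¬ μ ≈ 0#) where
    untwist : (ℕ → Carrier) → ℕ → Carrier
    untwist s k = s k * N k μ ⁻¹

    untwist-spec : ∀ s k → untwist s k * N k μ ≈ s k
    untwist-spec s k = /-cancel (N-≉0 k μ≉0)

    -- By N (j + k) μ = N k μ · σᵏ(N j μ), the new equation at k is the old one divided by N k μ.
    untwist-solves : ∀ {a b c d s} → Solves a b c d s → Solves (a * N 0 μ) (b * N 1 μ) (c * N 2 μ) (d * N 3 μ) (untwist s)
    untwist-solves {a} {b} {c} {d} {s} sol k = x*y≈0⇒y≈0 (N-≉0 k μ≉0) (begin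
      _ ≈⟨ solve 9 (λ m a b c d x y z w → m :* (a :* x :+ b :* y :+ c :* z :+ d :* w) :=
             m :* (a :* x) :+ m :* (b :* y) :+ m :* (c :* z) :+ m :* (d :* w)) refl (N k μ) _ _ _ _ _ _ _ _ ⟩
      _ ≈⟨ +-cong (+-cong (+-cong (term 0 a) (term 1 b)) (term 2 c)) (term 3 d) ⟩
      _ ≈⟨ sol k ⟩
      0# ∎)
      where
      term : ∀ j x → N k μ * (iter σ k (x * N j μ) * untwist s (j ℕ.+ k)) ≈ iter σ k x * s (j ℕ.+ k)
      term j x = begin
        N k μ * (iter σ k (x * N j μ) * untwist s (j ℕ.+ k))           ≈⟨ *-congˡ (*-congʳ (iter-* k _ _)) ⟩
        N k μ * (iter σ k x * iter σ k (N j μ) * untwist s (j ℕ.+ k))  ≈⟨ solve 4 (λ m x p u →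
          m :* (x :* p :* u) := x :* (u :* (m :* p))) refl _ _ _ _ ⟩
        iter σ k x * (untwist s (j ℕ.+ k) * (N k μ * iter σ k (N j μ)))  ≈⟨ *-congˡ (*-congˡ (N-+′ j k μ)) ⟨
        iter σ k x * (untwist s (j ℕ.+ k) * N (j ℕ.+ k) μ)             ≈⟨ *-congˡ (untwist-spec s (j ℕ.+ k)) ⟩
        iter σ k x * s (j ℕ.+ k)                                       ∎

    untwist-periodic : ∀ {s} → (∀ k → s (k ℕ.+ n) ≈ norm μ * s k) → ∀ k → untwist s (k ℕ.+ n) ≈ untwist s k
    untwist-periodic {s} s-periodic k = *-cancelʳ (N-≉0 (k ℕ.+ n) μ≉0) (begin
      untwist s (k ℕ.+ n) * N (k ℕ.+ n) μ  ≈⟨ untwist-spec s (k ℕ.+ n) ⟩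
      s (k ℕ.+ n)                          ≈⟨ s-periodic k ⟩
      norm μ * s k                         ≈⟨ *-congˡ (untwist-spec s k) ⟨
      norm μ * (untwist s k * N k μ)       ≈⟨ solve 3 (λ m u p → m :* (u :* p) := u :* (p :* m)) refl _ _ _ ⟩
      untwist s k * (N k μ * norm μ)       ≈⟨ *-congˡ (trans (N-+ k n μ) (*-congˡ (fixed-iter k (norm-fixed μ≉0)))) ⟨
      untwist s k * N (k ℕ.+ n) μ          ∎)

    -- For y = μ σ(x) / x the partial norms telescope: N j y · x = N j μ · σʲ(x).
    quotient-root : ∀ {a b c d x} → ¬ x ≈ 0# →
      a * N 0 μ * x + b * N 1 μ * iter σ 1 x + c * N 2 μ * iter σ 2 x + d * N 3 μ * iter σ 3 x ≈ 0# →
      P_L σ a b c d (μ * σ x * x ⁻¹) ≈ 0#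
    quotient-root {a} {b} {c} {d} {x} x≉0 zero-x = x*y≈0⇒x≈0 x≉0 (begin
      P_L σ a b c d y * x  ≈⟨ *-congʳ (P_L-norms a b c d y) ⟨
      (a * N 0 y + b * N 1 y + c * N 2 y + d * N 3 y) * x  ≈⟨ solve 9 (λ a b c d p q r s x →
        (a :* p :+ b :* q :+ c :* r :+ d :* s) :* x := a :* (p :* x) :+ b :* (q :* x) :+ c :* (r :* x) :+ d :* (s :* x))
        refl a b c d _ _ _ _ x ⟩
      _                    ≈⟨ +-cong (+-cong (+-cong (term 0 a) (term 1 b)) (term 2 c)) (term 3 d) ⟩
      _                    ≈⟨ zero-x ⟩
      0#                   ∎)
      where
      y = μ * σ x * x ⁻¹
      N-y : ∀ j → N j y * x ≈ N j μ * iter σ j x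
      N-y zero = refl
      N-y (suc j) = begin
        y * σ (N j y) * x                  ≈⟨ solve 3 (λ y p x → y :* p :* x := y :* x :* p) refl y _ x ⟩
        y * x * σ (N j y)                  ≈⟨ *-congʳ (/-cancel x≉0) ⟩
        μ * σ x * σ (N j y)                ≈⟨ trans (*-assoc _ _ _) (*-congˡ (*-comm _ _)) ⟩
        μ * (σ (N j y) * σ x)              ≈⟨ *-congˡ (trans (cong-σ (sym (N-y j))) (σ-* _ _)) ⟨
        μ * σ (N j μ * iter σ j x)         ≈⟨ trans (*-congˡ (σ-* _ _)) (sym (*-assoc _ _ _)) ⟩
        μ * σ (N j μ) * iter σ (suc j) x   ∎
      term : ∀ j a → a * (N j y * x) ≈ a * N j μ * iter σ j x
      term j a = trans (*-congˡ (N-y j)) (sym (*-assoc _ _ _))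

    -- Hence zeros of L' give the same root only if they represent the same projective point over
    -- Fix σ.
    quotient-proportional : ∀ {x x′} → ¬ x ≈ 0# → ¬ x′ ≈ 0# → μ * σ x * x ⁻¹ ≈ μ * σ x′ * x′ ⁻¹ →
                            Fixed (x * x′ ⁻¹)
    quotient-proportional {x} {x′} x≉0 x′≉0 eq = *-cancelʳ (x′≉0 ∘ σ≈0⇒≈0) (*-cancelˡ μ≉0 (*-cancelʳ (⁻¹-≉0 x≉0) (begin
      μ * (σ κ * σ x′) * x ⁻¹  ≈⟨ *-congʳ (*-congˡ (trans (sym (σ-* κ x′)) (cong-σ κx′≈x))) ⟩
      μ * σ x * x ⁻¹           ≈⟨ eq ⟩
      μ * σ x′ * x′ ⁻¹         ≈⟨ *-congˡ x′⁻¹≈κx⁻¹ ⟩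
      μ * σ x′ * (κ * x ⁻¹)    ≈⟨ solve 4 (λ m s k i → m :* s :* (k :* i) := m :* (k :* s) :* i) refl μ (σ x′) κ (x ⁻¹) ⟩
      μ * (κ * σ x′) * x ⁻¹    ∎)))
      where
      κ = x * x′ ⁻¹
      κx′≈x : κ * x′ ≈ x
      κx′≈x = /-cancel x′≉0
      x′⁻¹≈κx⁻¹ : x′ ⁻¹ ≈ κ * x ⁻¹
      x′⁻¹≈κx⁻¹ = *-cancelˡ x≉0 (trans (solve 2 (λ x i → x :* i := x :* i :* :1) refl x (x′ ⁻¹))
        (trans (*-congˡ (sym (⁻¹-inverse x x≉0))) (solve 3 (λ k x i → k :* (x :* i) := x :* (k :* i)) refl κ x (x ⁻¹))))

  private
    scalar : Fin q → Carrier
    scalar = proj₁ fixed-exactly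

    scalar-injective : ∀ {i j} → scalar i ≈ scalar j → i ≡ j
    scalar-injective = proj₁ (proj₂ fixed-exactly) _ _

    scalar-fixed : ∀ i → Fixed (scalar i)
    scalar-fixed = proj₁ (proj₂ (proj₂ fixed-exactly))

  -- An affine plane, an affine line at infinity and one last point, nested like the sum q² + q + 1.
  PlanePoint : Set
  PlanePoint = (Fin (q ℕ.^ 2) ⊎ Fin q) ⊎ Fin 1

  -- representatives of the points of P²(Fix σ) whose first nonzero coordinate is 1
  coordinates : PlanePoint → Fin 3 → Carrier
  coordinates (inj₁ (inj₁ k)) zero = 1#
  coordinates (inj₁ (inj₁ k)) (suc i) = scalar (Fin.finToFun {q} {2} k i)
  coordinates (inj₁ (inj₂ l)) zero = 0#
  coordinates (inj₁ (inj₂ l)) (suc zero) = 1#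
  coordinates (inj₁ (inj₂ l)) (suc (suc _)) = scalar l
  coordinates (inj₂ _) zero = 0#
  coordinates (inj₂ _) (suc zero) = 0#
  coordinates (inj₂ _) (suc (suc _)) = 1#

  coordinates-fixed : ∀ s i → Fixed (coordinates s i)
  coordinates-fixed (inj₁ (inj₁ k)) zero = σ-1
  coordinates-fixed (inj₁ (inj₁ k)) (suc i) = scalar-fixed _
  coordinates-fixed (inj₁ (inj₂ l)) zero = σ-0
  coordinates-fixed (inj₁ (inj₂ l)) (suc zero) = σ-1
  coordinates-fixed (inj₁ (inj₂ l)) (suc (suc _)) = scalar-fixed l
  coordinates-fixed (inj₂ _) zero = σ-0
  coordinates-fixed (inj₂ _) (suc zero) = σ-0
  coordinates-fixed (inj₂ _) (suc (suc _)) = σ-1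

  coordinates-≉0 : ∀ s → ¬ (∀ i → coordinates s i ≈ 0#)
  coordinates-≉0 (inj₁ (inj₁ k)) ≈0 = 1≉0 (≈0 zero)
  coordinates-≉0 (inj₁ (inj₂ l)) ≈0 = 1≉0 (≈0 (suc zero))
  coordinates-≉0 (inj₂ _) ≈0 = 1≉0 (≈0 (suc (suc zero)))

  -- Proportional triples have their first nonzero coordinate in the same place, and normalisation
  -- to 1 there forces κ = 1.
  coordinates-injective : ∀ κ s s′ → (∀ i → coordinates s i ≈ κ * coordinates s′ i) → s ≡ s′
  coordinates-injective κ = go
    where
    1≉κ0 : ¬ 1# ≈ κ * 0#
    1≉κ0 eq = 1≉0 (trans eq (zeroʳ κ))
    κ≈1 : ∀ {x y} → 1# ≈ κ * 1# → x ≈ κ * y → x ≈ y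
    κ≈1 eq e = trans e (trans (*-congʳ (trans (sym (*-identityʳ κ)) (sym eq))) (*-identityˡ _))
    κ≉0 : ∀ {x} → 0# ≈ κ * 1# → ¬ 1# ≈ κ * x
    κ≉0 eq e = 1≉0 (trans e (trans (*-congʳ (trans (sym (*-identityʳ κ)) (sym eq))) (zeroˡ _)))
    go : ∀ s s′ → (∀ i → coordinates s i ≈ κ * coordinates s′ i) → s ≡ s′
    go (inj₁ (inj₁ k)) (inj₁ (inj₁ k′)) eq = ≡.cong (inj₁ ∘ inj₁) (finToFun-injective {2} {q}
      (λ i → scalar-injective (κ≈1 (eq zero) (eq (suc i)))))
    go (inj₁ (inj₁ k)) (inj₁ (inj₂ _)) eq = contradiction (eq zero) 1≉κ0
    go (inj₁ (inj₁ k)) (inj₂ _) eq = contradiction (eq zero) 1≉κ0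
    go (inj₁ (inj₂ l)) (inj₁ (inj₁ _)) eq = contradiction (eq (suc zero)) (κ≉0 (eq zero))
    go (inj₁ (inj₂ l)) (inj₁ (inj₂ l′)) eq = ≡.cong (inj₁ ∘ inj₂)
      (scalar-injective (κ≈1 (eq (suc zero)) (eq (suc (suc zero)))))
    go (inj₁ (inj₂ l)) (inj₂ _) eq = contradiction (eq (suc zero)) 1≉κ0
    go (inj₂ _) (inj₁ (inj₁ _)) eq = contradiction (eq (suc (suc zero))) (κ≉0 (eq zero))
    go (inj₂ _) (inj₁ (inj₂ _)) eq = contradiction (eq (suc (suc zero))) (κ≉0 (eq (suc zero)))
    go (inj₂ zero) (inj₂ zero) eq = ≡.refl

  toPlanePoint : Fin (q ℕ.^ 2 ℕ.+ q ℕ.+ 1) → PlanePoint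
  toPlanePoint i = Sum.map₁ (Fin.splitAt (q ℕ.^ 2)) (Fin.splitAt (q ℕ.^ 2 ℕ.+ q) i)

  toPlanePoint-injective : ∀ {i j} → toPlanePoint i ≡ toPlanePoint j → i ≡ j
  toPlanePoint-injective {i} {j} eq = ≡.trans (≡.sym (fromTo i)) (≡.trans (≡.cong from eq) (fromTo j))
    where
    from : PlanePoint → Fin (q ℕ.^ 2 ℕ.+ q ℕ.+ 1)
    from (inj₁ s) = Fin.join (q ℕ.^ 2 ℕ.+ q) 1 (inj₁ (Fin.join (q ℕ.^ 2) q s))
    from (inj₂ k) = Fin.join (q ℕ.^ 2 ℕ.+ q) 1 (inj₂ k)
    fromTo : ∀ i → from (toPlanePoint i) ≡ i
    fromTo i with Fin.splitAt (q ℕ.^ 2 ℕ.+ q) i | Finₚ.join-splitAt (q ℕ.^ 2 ℕ.+ q) 1 i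
    ... | inj₁ k | joined = ≡.trans (≡.cong (λ k → Fin.join (q ℕ.^ 2 ℕ.+ q) 1 (inj₁ k)) (Finₚ.join-splitAt (q ℕ.^ 2) q k)) joined
    ... | inj₂ k | joined = joined

  scalar⇒roots : ∀ {a b c d s} → ¬ a ≈ 0# → ¬ d ≈ 0# → Solves a b c d s → s 0 ≈ 0# → s 1 ≈ 0# → s 2 ≈ 1# →
    ∀ m → n ≡ suc (suc (suc m)) → s n ≈ 0# → s (suc n) ≈ 0# → Fixed (s (suc (suc n))) →
    HasExactly (λ y → P_L σ a b c d y ≈ 0#) (q ℕ.^ 2 ℕ.+ q ℕ.+ 1)
  scalar⇒roots {a} {b} {c} {d} {s} a≉0 d≉0 sol s₀ s₁ s₂ m n≡3+m sₙ sₙ₊₁ fλ =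
    root , root-injective , root-root ,
    -- The roots constructed below already attain the upper bound 1 + (1 + q) q, so none is missing.
    AtMost⇒complete (AtMost-mono (ℕₚ.≤-reflexive (1+[1+q]q≡q²+q+1 q)) (AtMost-P_L-roots a≉0 d≉0 (root-≉0 a≉0)))
      root root-root root-injective
    where
    open Solutions {a} {b} {c} {d}
    λ₀ = s (suc (suc n))

    λ₀≉0 : ¬ λ₀ ≈ 0#
    λ₀≉0 λ₀≈0 = 1≉0 (trans (sym s₂) (vanishes-back sol a≉0 n sₙ sₙ₊₁ λ₀≈0))

    s-periodic : ∀ k → s (k ℕ.+ n) ≈ λ₀ * s k
    s-periodic k = x-y≈0⇒x≈y (vanishes (solves-sub (solves-shift sol) (solves-scale λ₀ sol)) d≉0
      (x≈y⇒x-y≈0 (trans sₙ (sym (trans (*-congˡ s₀) (zeroʳ _)))))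
      (x≈y⇒x-y≈0 (trans sₙ₊₁ (sym (trans (*-congˡ s₁) (zeroʳ _)))))
      (x≈y⇒x-y≈0 (sym (trans (*-congˡ s₂) (*-identityʳ _)))) k)

    surjective = norm-surjective λ₀≉0 fλ
    μ = proj₁ surjective
    μ≉0 = proj₁ (proj₂ surjective)
    norm-μ = proj₂ (proj₂ surjective)

    f : ℕ → Carrier
    f = untwist μ≉0 s

    f-solves : Solves (a * N 0 μ) (b * N 1 μ) (c * N 2 μ) (d * N 3 μ) f
    f-solves = untwist-solves μ≉0 sol

    f-periodic : ∀ k → f (k ℕ.+ n) ≈ f k
    f-periodic = untwist-periodic μ≉0 (λ k → trans (s-periodic k) (*-congʳ (sym norm-μ)))

    f≈0 : ∀ k → s k ≈ 0# → f k ≈ 0#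
    f≈0 k eq = trans (*-congʳ eq) (zeroˡ _)

    f₂≉0 : ¬ f 2 ≈ 0#
    f₂≉0 = *-≉0 (≉0-resp (sym s₂) 1≉0) (⁻¹-≉0 (N-≉0 2 μ≉0))

    as : List Carrier
    as = traceCoefficients f (suc m)

    values-zero : ∀ t → let x = apply as t in
      a * N 0 μ * x + b * N 1 μ * iter σ 1 x + c * N 2 μ * iter σ 2 x + d * N 3 μ * iter σ 3 x ≈ 0#
    values-zero t = trans (+-cong (+-cong (+-cong (*-congˡ x≈) (*-congˡ (iter-cong 1 x≈)))
                         (*-congˡ (iter-cong 2 x≈))) (*-congˡ (iter-cong 3 x≈)))
                         (Trace.trace-zero t′ f f-periodic f-solves)
      where
      -- The trace of t′ is given by the operator at σ(t′), whereas the independent values are taken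
      -- at arbitrary arguments.
      t′ = proj₁ (σ-surj t)
      x≈ : apply as t ≈ Trace.trace t′ f n 0
      x≈ = trans (apply-cong as (sym (proj₂ (σ-surj t))))
             (trans (sym (apply-traceCoefficients (f≈0 0 s₀) (f≈0 1 s₁) t′ (suc m)))
             (reflexive (≡.cong (λ k → Trace.trace t′ f k 0) (≡.sym n≡3+m))))

    -- With n - 2 terms in the operator, three values exactly meet the length bound n + 1.
    basis = independent-values 3 (traceCoefficients-top f₂≉0 m) (ℕₚ.≤-reflexive
      (≡.trans (≡.cong (ℕ._+ 3) (length-traceCoefficients f (suc m)))
        (≡.trans (ℕₚ.+-comm (suc m) 3) (≡.cong suc (≡.sym n≡3+m)))))
    t = proj₁ basis
    t-independent = proj₂ basis

    value : PlanePoint → Carrier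
    value p = apply as (combine (coordinates p) t)

    value-≉0 : ∀ p → ¬ value p ≈ 0#
    value-≉0 p ≈0 = coordinates-≉0 p (t-independent (coordinates p) (coordinates-fixed p) ≈0)

    value-injective : ∀ p p′ → Fixed (value p * value p′ ⁻¹) → p ≡ p′
    value-injective p p′ fκ = coordinates-injective κ p p′ λ i → x-y≈0⇒x≈y (t-independent
      (λ i → coordinates p i - κ * coordinates p′ i)
      (λ i → fixed-sub (coordinates-fixed p i) (fixed-* fκ (coordinates-fixed p′ i)))
      (begin
        apply as (combine (λ i → coordinates p i - κ * coordinates p′ i) t)
          ≈⟨ apply-cong as (trans (combine-sub (coordinates p) (λ i → κ * coordinates p′ i) t)
               (+-congˡ (-‿cong (combine-scale κ (coordinates p′) t)))) ⟩
        apply as (combine (coordinates p) t - κ * combine (coordinates p′) t)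
          ≈⟨ solve 2 (λ x y → x := x :+ y :- y) refl _ (κ * value p′) ⟩
        apply as (combine (coordinates p) t - κ * combine (coordinates p′) t) + κ * value p′ - κ * value p′
          ≈⟨ +-congʳ (trans (+-congˡ (sym (apply-scale as fκ _))) (sym (apply-+ as _ _))) ⟩
        apply as ((combine (coordinates p) t - κ * combine (coordinates p′) t) + κ * combine (coordinates p′) t) - κ * value p′
          ≈⟨ +-congʳ (apply-cong as (solve 2 (λ x y → x :- y :+ y := x) refl _ _)) ⟩
        value p - κ * value p′
          ≈⟨ x≈y⇒x-y≈0 (sym (/-cancel (value-≉0 p′))) ⟩
        0#  ∎) i)
      where κ = value p * value p′ ⁻¹

    root : Fin (q ℕ.^ 2 ℕ.+ q ℕ.+ 1) → Carrier
    root i = let x = value (toPlanePoint i) in μ * σ x * x ⁻¹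

    root-root : ∀ i → P_L σ a b c d (root i) ≈ 0#
    root-root i = quotient-root μ≉0 (value-≉0 (toPlanePoint i)) (values-zero _)

    root-injective : ∀ i j → root i ≈ root j → i ≡ j
    root-injective i j eq = toPlanePoint-injective (value-injective (toPlanePoint i) (toPlanePoint j)
      (quotient-proportional μ≉0 (value-≉0 (toPlanePoint i)) (value-≉0 (toPlanePoint j)) eq))

-- Translation between the solution and H

module Criterion (F : Field) (q n : ℕ) (2≤q : 2 ≤ q) (m : ℕ) (n≡3+m : n ≡ 3 ℕ.+ m)
                 (card : FieldDefs.HasCard F (q ℕ.^ n))
                 (σ : Field.Carrier F → Field.Carrier F) (gen : FieldDefs.IsGaloisGenerator F q n σ) where
  open FieldDefs F hiding (zero)
  open FieldProperties F
  open Automorphism F q n σ gen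

  1≤n : 1 ≤ n
  1≤n = ≡.subst (1 ≤_) (≡.sym n≡3+m) (s≤s z≤n)

  open Galois F q n 2≤q 1≤n card σ gen
  open Recurrence F q n 2≤q 1≤n card σ gen
  open Forward F q n 2≤q 1≤n card σ gen
  open Backward F q n 2≤q 1≤n card σ gen

  module Nonzero {a b c d : Carrier} (a≉0 : ¬ a ≈ 0#) (b≉0 : ¬ b ≈ 0#) (c≉0 : ¬ c ≈ 0#) (d≉0 : ¬ d ≈ 0#) where
    open Fundamental {a} b≉0 c≉0 d≉0

    -- The solution starts with two zeros before H₀, so its index runs two ahead of that of H.
    e-n : e n ≈ N (suc m) r * H σ w z (n ∸ 2)
    e-n rewrite n≡3+m = refl

    e-1+n : e (suc n) ≈ N (suc (suc m)) r * H σ w z (n ∸ 1)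
    e-1+n rewrite n≡3+m = refl

    roots⇒H : HasExactly (λ y → P_L σ a b c d y ≈ 0#) (q ^ 2 +ℕ q +ℕ 1) →
              H σ w z (n ∸ 1) ≈ 0# × H σ w z (n ∸ 2) ≈ 0# × pow (H σ w z n) q ≈ H σ w z n
    roots⇒H exact =
      let eₙ , eₙ₊₁ , fixed = quadrangle⇒scalar a≉0 d≉0 (quadrangle (root-≉0 a≉0) exact) e-solves refl refl e₂≈1
      in x*y≈0⇒y≈0 (N-≉0 (suc (suc m)) r≉0) (trans (sym e-1+n) eₙ₊₁) ,
         x*y≈0⇒y≈0 (N-≉0 (suc m) r≉0) (trans (sym e-n) eₙ) ,
         -- The term at n + 2 is norm r times Hₙ, and the nonzero factor norm r is fixed by σ, so
         -- fixedness passes to Hₙ.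
         fixed⇒frobenius-fixed (*-cancelˡ (N-≉0 n r≉0)
           (trans (*-congʳ (sym (norm-fixed r≉0))) (trans (sym (σ-* _ _)) fixed)))

    H⇒roots : H σ w z (n ∸ 1) ≈ 0# × H σ w z (n ∸ 2) ≈ 0# × pow (H σ w z n) q ≈ H σ w z n →
         HasExactly (λ y → P_L σ a b c d y ≈ 0#) (q ^ 2 +ℕ q +ℕ 1)
    H⇒roots (Hₙ₋₁ , Hₙ₋₂ , Hₙ) = scalar⇒roots a≉0 d≉0 e-solves refl refl e₂≈1 m n≡3+m
      (trans e-n (trans (*-congˡ Hₙ₋₂) (zeroʳ _)))
      (trans e-1+n (trans (*-congˡ Hₙ₋₁) (zeroʳ _)))
      (fixed-* (norm-fixed r≉0) (σ-fixes-Fq _ Hₙ))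

theorem12 : (F : Field) → let open FieldDefs F in
    (q n : ℕ) → IsPrimePower q → 3 ≤ n → HasCard (q ^ n) →
    (σ : Carrier → Carrier) → IsGaloisGenerator q n σ →
    (a b c d : Carrier) → ¬ ((a * b * c * d) ≈ 0#) →
    HasExactly (λ y → P_L σ a b c d y ≈ 0#) (q ^ 2 +ℕ q +ℕ 1)
    ⇔ ((H σ (wL σ a b c) (zL σ b c d) (n ∸ 1) ≈ 0#)
    × (H σ (wL σ a b c) (zL σ b c d) (n ∸ 2) ≈ 0#)
    × (pow (H σ (wL σ a b c) (zL σ b c d) n) q ≈ H σ (wL σ a b c) (zL σ b c d) n))
theorem12 F q n q-primePower 3≤n card σ gen a b c d abcd≉0 =
  mk⇔ roots⇒H H⇒roots
  where
  open FieldProperties F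
  open Criterion F q n (primePower-≥2 q-primePower) (n ∸ 3) (≡.sym (ℕₚ.m+[n∸m]≡n 3≤n)) card σ gen
  a≉0 = *-≉0⇒≉0ˡ (*-≉0⇒≉0ˡ (*-≉0⇒≉0ˡ abcd≉0))
  b≉0 = *-≉0⇒≉0ʳ (*-≉0⇒≉0ˡ (*-≉0⇒≉0ˡ abcd≉0))
  c≉0 = *-≉0⇒≉0ʳ (*-≉0⇒≉0ˡ abcd≉0)
  d≉0 = *-≉0⇒≉0ʳ abcd≉0
  open Nonzero {a} {b} {c} {d} a≉0 b≉0 c≉0 d≉0
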